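{- Let $p\ge 5$ be a prime and let $a$ and $k$ be integers such that $1\le a\le p-1$ and $2\le k\le ap-2$. Then each of the following is true: (i) If $k\equiv \epsilon_k\pmod{p-1}$, then $v_p(s(ap,ap-k))=(v_p(k)+1)\epsilon_k$. (ii) If $2\le k\le a(p-1)-1$ and $k\not\equiv \epsilon_k\pmod{p-1}$, then $v_p(s(ap,ap-k))\ge (v_p(k)+1)\epsilon_k+1$, where equality holds if and only if $v_p\big(B_{2\lfloor \langle k\rangle/2\rfloor}\big)=0$. In particular, if $p$ is regular, then $v_p(s(ap,ap-k))=(v_p(k)+1)\epsilon_k+1$. (iii) If $a\ge 4$ and $a(p-1)+2\le k\le ap-2$, then $v_p(s(ap,ap-k))\ge a+k-ap$.
   Context: For nonnegative integers $n,k$, the (unsigned) Stirling numbers of the first kind $s(n,k)$ are defined by $x(x+1)\cdots(x+n-1)=\sum_{k=0}^n s(n,k)x^k$. For a prime $p$ and a nonzero rational $x=n_1/n_2$, $v_p(x)=v_p(n_1)-v_p(n_2)$ is the $p$-adic valuation. For an integer $k$, $\epsilon_k=0$ if $k$ is even and $\epsilon_k=1$ if $k$ is odd; $\langle k\rangle$ denotes the integer with $0\le\langle k\rangle\le p-2$ and $k\equiv\langle k\rangle\pmod{p-1}$. The Bernoulli numbers $B_n$ are defined by $\frac{x}{e^x-1}=\sum_{n\ge0}B_n\frac{x^n}{n!}$. A prime $p$ is regular if $v_p(B_l)=0$ for all even $l$ with $2\le l\le p-3$. -}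

module Defs where

open import Data.Nat using (ℕ; zero; suc; _+_; _*_; _∸_; _/_; _%_)
open import Data.Nat.Divisibility using (_∣?_)
open import Data.Nat.Combinatorics using (_C_)
open import Data.List using (List; []; _∷_; foldr; zipWith; reverse; upTo)
open import Data.Integer as ℤ using (ℤ; +_; ∣_∣)
open import Data.Rational as ℚ using (ℚ; ↥_; ↧ₙ_)
open import Relation.Nullary using (yes; no)

-- Polynomials with ℕ coefficients as coefficient lists (constant term first)

Poly : Set
Poly = List ℕ

scale : ℕ → Poly → Poly
scale c []       = []
scale c (x ∷ xs) = c * x ∷ scale c xs

addP : Poly → Poly → Poly
addP []       ys       = ys
addP xs       []       = xs
addP (x ∷ xs) (y ∷ ys) = x + y ∷ addP xs ys

mulXplus : ℕ → Poly → Poly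
mulXplus c f = addP (0 ∷ f) (scale c f)

rising : ℕ → Poly
rising zero    = 1 ∷ []
rising (suc n) = mulXplus n (rising n)

coeff : ℕ → Poly → ℕ
coeff k       []       = 0
coeff zero    (x ∷ xs) = x
coeff (suc k) (x ∷ xs) = coeff k xs

-- unsigned Stirling numbers of the first kind:
-- x(x+1)⋯(x+n-1) = Σ_k s(n,k) x^k
stirling1 : ℕ → ℕ → ℕ
stirling1 n k = coeff k (rising n)

-- fuel-bounded: number of times p divides n (fuel n suffices for p ≥ 2)
vpAux : ℕ → ℕ → ℕ → ℕ
vpAux zero    p       n       = 0
vpAux (suc f) zero    n       = 0
vpAux (suc f) (suc q) zero    = 0
vpAux (suc f) (suc q) (suc m) with suc q ∣? suc m
... | yes _ = suc (vpAux f (suc q) (suc m / suc q))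
... | no  _ = 0

-- v_p(n) for a positive natural number n (junk value 0 at n = 0)
vp : ℕ → ℕ → ℕ
vp p n = vpAux n p n

-- v_p(x) = v_p(n₁) - v_p(n₂) for a rational x = n₁/n₂ (junk 0 at x = 0)
vpℚ : ℕ → ℚ → ℤ
vpℚ p x = (+ vp p ∣ ↥ x ∣) ℤ.- (+ vp p (↧ₙ x))

-- Bernoulli numbers, x/(e^x-1) = Σ B_n x^n/n!, via the equivalent
-- coefficient identity  Σ_{j=0}^{m} C(m+1,j) B_j = 0 (m ≥ 1), B_0 = 1.

-- bernRev n = [B_n, B_{n-1}, …, B_0]
bernRev : ℕ → List ℚ
bernRev zero    = ℚ.1ℚ ∷ []
bernRev (suc n) = next ∷ prev
  where
  prev : List ℚ
  prev = bernRev n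
  s : ℚ
  s = foldr ℚ._+_ ℚ.0ℚ (zipWith (λ j b → (+ ((suc (suc n)) C j) ℚ./ 1) ℚ.* b) (upTo (suc n)) (reverse prev))
  next : ℚ
  next = ℚ.- ((+ 1 ℚ./ suc (suc n)) ℚ.* s)

headℚ : List ℚ → ℚ
headℚ []      = ℚ.0ℚ
headℚ (x ∷ _) = x

bernoulli : ℕ → ℚ
bernoulli n = headℚ (bernRev n)

ε : ℕ → ℕ
ε k = k % 2

_mod_ : ℕ → ℕ → ℕ
a mod zero  = a
a mod suc m = a % suc m

⟨_⟩[_] : ℕ → ℕ → ℕ
⟨ k ⟩[ p ] = k mod (p ∸ 1)

open import Data.Nat using (_≤_)
open import Relation.Binary.PropositionalEquality using (_≡_)
Regular : ℕ → Set
Regular p = ∀ l → l % 2 ≡ 0 → 2 ≤ l → l ≤ p ∸ 3 → vpℚ p (bernoulli l) ≡ + 0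

private
  open Relation.Binary.PropositionalEquality using (refl)
  _ : bernoulli 1 ≡ ℚ.- (+ 1 ℚ./ 2)
  _ = refl
  _ : bernoulli 12 ≡ ℚ.- (+ 691 ℚ./ 2730)
  _ = refl
  _ : stirling1 5 2 ≡ 50
  _ = refl
  _ : vp 5 250 ≡ 3
  _ = refl
  _ : vpℚ 691 (bernoulli 12) ≡ + 1
  _ = refl

-- s(ap, ap - k) is the k-th coefficient of the product of 1 + i t over i < ap, which splits into a
-- blocks of p consecutive i. Modulo p each block is 1 - t^(p-1). For even l with 2 ≤ l ≤ p - 3 its
-- l-th coefficient is -p B_l / l modulo p², by Newton's identities and because the power sums
-- 1^l + … + (p-1)^l and the numbers p B_l satisfy the same recurrence modulo p². Multiplying the blocks
-- gives s(ap, ap - k) modulo p for all k, and modulo p² for even k. For odd k the symmetry i ↦ ap - i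
-- gives 2 s(ap, ap - k) ≡ (ap - k) ap s(ap, ap - k + 1) up to terms of higher valuation. Part (iii)
-- holds because the top coefficient of each block is divisible by p.
--
-- The convention v_p(0) = 0 makes B_l ≠ 0 for even l necessary; it holds because 2 B_l is a 2-adic unit.
module Submission where

-- For odd k the equality test in (ii) needs f k modulo p^(v_p(k) + 3), where f k = s(ap, ap - k).
-- As k < ap < p², v_p(k) is at most 1, so p^4 always suffices. Hence the reflection is expanded to
-- third order, with a remainder divisible by (ap)^4. The quadratic term gains its missing p from f
-- (k - 2): the index k - 2 is odd, hence no multiple of the even number p - 1. The Taylor
-- coefficients are scaled by 3! to stay in ℤ; the factors 6 and 12 that result are units because p
-- ≥ 5. The Bernoulli part has one device. If (1 + X)^n = X^n holds umbrally modulo a subgroup of ℚ,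
-- the two top terms of the binomial expansion give (m + 1) X_m = 0 once the earlier X_j vanish. So
-- X vanishes as long as m + 1 can be cancelled. Modulo 0 this gives B_n = 0 for odd n ≥ 3, modulo p
-- the power sums, modulo p² their difference from p B_l. Modulo 2 it works at even m only, and the
-- vanishing of the odd Bernoulli numbers fills the gaps.

-- Elementary symmetric functions as power series coefficients; Newton's identities.

module SymmetricFunctions where
  open import Data.Nat as ℕ using (ℕ; zero; suc)
  import Data.Nat.Properties as ℕ
  open import Data.Integer hiding (suc)
  open import Data.Integer.Properties
  open import Data.Integer.Tactic.RingSolver using (solve-∀)
  open import Function using (_∘_)
  open import Relation.Binary.PropositionalEquality
  open ≡-Reasoning

  -- A function ℕ → ℤ stands for the power series in t with these coefficients: δ m is t^m,
  -- mulLin x is multiplication by 1 + x t, and conv is the product.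
  δ : ℕ → ℕ → ℤ
  δ zero    zero    = 1ℤ
  δ zero    (suc i) = 0ℤ
  δ (suc m) zero    = 0ℤ
  δ (suc m) (suc i) = δ m i

  mulLin : ℤ → (ℕ → ℤ) → ℕ → ℤ
  mulLin x f zero    = f zero
  mulLin x f (suc k) = f (suc k) + x * f k

  -- ∏_{i<n} (1 + φ i t), whose coefficients are the elementary symmetric functions of the φ i.
  E : (ℕ → ℤ) → ℕ → ℕ → ℤ
  E φ zero    = δ 0
  E φ (suc n) = mulLin (φ n) (E φ n)

  conv : (f g : ℕ → ℤ) → ℕ → ℤ
  conv f g zero    = f 0 * g 0
  conv f g (suc k) = f 0 * g (suc k) + conv (f ∘ suc) g k

  power-sum : (ℕ → ℤ) → ℕ → ℕ → ℤ
  power-sum φ zero    j = 0ℤ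
  power-sum φ (suc n) j = power-sum φ n j + φ n ^ j

  δ-diag : ∀ m → δ m m ≡ 1ℤ
  δ-diag zero    = refl
  δ-diag (suc m) = δ-diag m

  δ-off : ∀ {m i} → i ≢ m → δ m i ≡ 0ℤ
  δ-off {zero}  {zero}  i≢m with () ← i≢m refl
  δ-off {zero}  {suc i} i≢m = refl
  δ-off {suc m} {zero}  i≢m = refl
  δ-off {suc m} {suc i} i≢m = δ-off (i≢m ∘ cong suc)

  mulLin-cong : ∀ {x y f g} → x ≡ y → f ≗ g → mulLin x f ≗ mulLin y g
  mulLin-cong x≡y f≗g zero    = f≗g zero
  mulLin-cong x≡y f≗g (suc k) = cong₂ _+_ (f≗g (suc k)) (cong₂ _*_ x≡y (f≗g k))

  mulLin-comm : ∀ x y f → mulLin x (mulLin y f) ≗ mulLin y (mulLin x f)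
  mulLin-comm x y f zero          = refl
  mulLin-comm x y f (suc zero)    = identity x y (f 1) (f 0)
    where
    identity : ∀ x y a b → a + y * b + x * b ≡ a + x * b + y * b
    identity = solve-∀
  mulLin-comm x y f (suc (suc k)) = identity x y (f (suc (suc k))) (f (suc k)) (f k)
    where
    identity : ∀ x y a b c → a + y * b + x * (b + y * c) ≡ a + x * b + y * (b + x * c)
    identity = solve-∀

  mulLin-0 : ∀ f → mulLin 0ℤ f ≗ f
  mulLin-0 f zero    = refl
  mulLin-0 f (suc k) = +-identityʳ (f (suc k))

  E-cong : ∀ {φ ψ} → φ ≗ ψ → ∀ n → E φ n ≗ E ψ n
  E-cong φ≗ψ zero    k = refl
  E-cong φ≗ψ (suc n) k = mulLin-cong (φ≗ψ n) (E-cong φ≗ψ n) k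

  E-0 : ∀ φ n → E φ n 0 ≡ 1ℤ
  E-0 φ zero    = refl
  E-0 φ (suc n) = E-0 φ n

  E-vanish : ∀ φ {n k} → n ℕ.< k → E φ n k ≡ 0ℤ
  E-vanish φ {zero}  {suc k} n<k = refl
  E-vanish φ {suc n} {suc k} (ℕ.s≤s n<k) = begin
    E φ n (suc k) + φ n * E φ n k ≡⟨ cong₂ (λ a b → a + φ n * b) (E-vanish φ (ℕ.m<n⇒m<1+n n<k)) (E-vanish φ n<k) ⟩
    0ℤ + φ n * 0ℤ                 ≡⟨ cong (_+_ 0ℤ) (*-zeroʳ (φ n)) ⟩
    0ℤ                            ∎

  E-head : ∀ φ n → E φ (suc n) ≗ mulLin (φ 0) (E (φ ∘ suc) n)
  E-head φ zero    k = refl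
  E-head φ (suc n) k = begin
    mulLin (φ (suc n)) (E φ (suc n)) k                          ≡⟨ mulLin-cong refl (E-head φ n) k ⟩
    mulLin (φ (suc n)) (mulLin (φ 0) (E (φ ∘ suc) n)) k         ≡⟨ mulLin-comm (φ (suc n)) (φ 0) (E (φ ∘ suc) n) k ⟩
    mulLin (φ 0) (mulLin (φ (suc n)) (E (φ ∘ suc) n)) k         ∎

  -- The last factor of the progression is the first factor of the reversed one: `E` splits it off
  -- at one end, `E-head` at the other.
  E-reverse : ∀ c n → E (λ i → c + + i) n ≗ E (λ i → c + + n - 1ℤ - + i) n
  E-reverse c zero    k = refl
  E-reverse c (suc n) k = begin
    mulLin (c + + n) (E (λ i → c + + i) n) k
      ≡⟨ mulLin-cong (first c (+ n)) (λ j → trans (E-reverse c n j) (E-cong (λ i → rest c (+ n) (+ i)) n j)) k ⟩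
    mulLin (c + (1ℤ + + n) - 1ℤ - + 0) (E (λ i → c + (1ℤ + + n) - 1ℤ - + (suc i)) n) k
      ≡⟨ E-head (λ i → c + + (suc n) - 1ℤ - + i) n k ⟨
    E (λ i → c + + (suc n) - 1ℤ - + i) (suc n) k ∎
    where
    first : ∀ c n → c + n ≡ c + (1ℤ + n) - 1ℤ - 0ℤ
    first = solve-∀
    rest : ∀ c n i → c + n - 1ℤ - i ≡ c + (1ℤ + n) - 1ℤ - (1ℤ + i)
    rest = solve-∀

  E-neg : ∀ φ n k → E (λ i → - φ i) n k ≡ -1ℤ ^ k * E φ n k
  E-neg φ zero    zero    = refl
  E-neg φ zero    (suc k) = sym (*-zeroʳ (-1ℤ ^ suc k))
  E-neg φ (suc n) zero    = E-neg φ n zero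
  E-neg φ (suc n) (suc k) = begin
    E (λ i → - φ i) n (suc k) + - φ n * E (λ i → - φ i) n k
      ≡⟨ cong₂ (λ a b → a + - φ n * b) (E-neg φ n (suc k)) (E-neg φ n k) ⟩
    -1ℤ * -1ℤ ^ k * E φ n (suc k) + - φ n * (-1ℤ ^ k * E φ n k)
      ≡⟨ identity (-1ℤ ^ k) (φ n) (E φ n (suc k)) (E φ n k) ⟩
    -1ℤ * -1ℤ ^ k * (E φ n (suc k) + φ n * E φ n k) ∎
    where
    identity : ∀ s x a b → -1ℤ * s * a + - x * (s * b) ≡ -1ℤ * s * (a + x * b)
    identity = solve-∀

  conv-cong : ∀ {f f′ g g′} → f ≗ f′ → g ≗ g′ → conv f g ≗ conv f′ g′
  conv-cong f≗ g≗ zero    = cong₂ _*_ (f≗ 0) (g≗ 0)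
  conv-cong f≗ g≗ (suc k) = cong₂ _+_ (cong₂ _*_ (f≗ 0) (g≗ (suc k))) (conv-cong (f≗ ∘ suc) g≗ k)

  conv-linearˡ : ∀ c f f′ g k → conv (λ i → f i + c * f′ i) g k ≡ conv f g k + c * conv f′ g k
  conv-linearˡ c f f′ g zero    = identity c (f 0) (f′ 0) (g 0)
    where
    identity : ∀ c a a′ b → (a + c * a′) * b ≡ a * b + c * (a′ * b)
    identity = solve-∀
  conv-linearˡ c f f′ g (suc k) = begin
    (f 0 + c * f′ 0) * g (suc k) + conv (λ i → f (suc i) + c * f′ (suc i)) g k
      ≡⟨ cong (_+_ ((f 0 + c * f′ 0) * g (suc k))) (conv-linearˡ c (f ∘ suc) (f′ ∘ suc) g k) ⟩
    (f 0 + c * f′ 0) * g (suc k) + (conv (f ∘ suc) g k + c * conv (f′ ∘ suc) g k)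
      ≡⟨ identity c (f 0) (f′ 0) (g (suc k)) (conv (f ∘ suc) g k) (conv (f′ ∘ suc) g k) ⟩
    f 0 * g (suc k) + conv (f ∘ suc) g k + c * (f′ 0 * g (suc k) + conv (f′ ∘ suc) g k) ∎
    where
    identity : ∀ c a a′ b d d′ → (a + c * a′) * b + (d + c * d′) ≡ a * b + d + c * (a′ * b + d′)
    identity = solve-∀

  conv-linearʳ : ∀ c f g g′ k → conv f (λ i → g i + c * g′ i) k ≡ conv f g k + c * conv f g′ k
  conv-linearʳ c f g g′ zero    = identity c (f 0) (g 0) (g′ 0)
    where
    identity : ∀ c a b b′ → a * (b + c * b′) ≡ a * b + c * (a * b′)
    identity = solve-∀
  conv-linearʳ c f g g′ (suc k) = begin
    f 0 * (g (suc k) + c * g′ (suc k)) + conv (f ∘ suc) (λ i → g i + c * g′ i) k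
      ≡⟨ cong (_+_ (f 0 * (g (suc k) + c * g′ (suc k)))) (conv-linearʳ c (f ∘ suc) g g′ k) ⟩
    f 0 * (g (suc k) + c * g′ (suc k)) + (conv (f ∘ suc) g k + c * conv (f ∘ suc) g′ k)
      ≡⟨ identity c (f 0) (g (suc k)) (g′ (suc k)) (conv (f ∘ suc) g k) (conv (f ∘ suc) g′ k) ⟩
    f 0 * g (suc k) + conv (f ∘ suc) g k + c * (f 0 * g′ (suc k) + conv (f ∘ suc) g′ k) ∎
    where
    identity : ∀ c a b b′ d d′ → a * (b + c * b′) + (d + c * d′) ≡ a * b + d + c * (a * b′ + d′)
    identity = solve-∀

  conv-zeroˡ : ∀ g k → conv (λ _ → 0ℤ) g k ≡ 0ℤ
  conv-zeroˡ g zero    = refl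
  conv-zeroˡ g (suc k) = cong (_+_ 0ℤ) (conv-zeroˡ g k)

  conv-zeroʳ : ∀ f k → conv f (λ _ → 0ℤ) k ≡ 0ℤ
  conv-zeroʳ f zero    = *-zeroʳ (f 0)
  conv-zeroʳ f (suc k) = cong₂ _+_ (*-zeroʳ (f 0)) (conv-zeroʳ (f ∘ suc) k)

  conv-δ : ∀ m g k → conv (δ m) g (m ℕ.+ k) ≡ g k
  conv-δ zero    g zero    = *-identityˡ (g 0)
  conv-δ zero    g (suc k) = begin
    1ℤ * g (suc k) + conv (λ _ → 0ℤ) g k ≡⟨ cong₂ _+_ (*-identityˡ (g (suc k))) (conv-zeroˡ g k) ⟩
    g (suc k) + 0ℤ                       ≡⟨ +-identityʳ (g (suc k)) ⟩
    g (suc k)                            ∎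
  conv-δ (suc m) g k       = trans (+-identityˡ _) (conv-δ m g k)

  conv-δ-< : ∀ {m k} g → k ℕ.< m → conv (δ m) g k ≡ 0ℤ
  conv-δ-< {suc m} {zero}  g k<m         = refl
  conv-δ-< {suc m} {suc k} g (ℕ.s≤s k<m) = trans (+-identityˡ _) (conv-δ-< g k<m)

  conv-mulLin : ∀ x f g → conv (mulLin x f) g ≗ mulLin x (conv f g)
  conv-mulLin x f g zero    = refl
  conv-mulLin x f g (suc k) = begin
    f 0 * g (suc k) + conv (λ i → f (suc i) + x * f i) g k
      ≡⟨ cong (_+_ (f 0 * g (suc k))) (conv-linearˡ x (f ∘ suc) f g k) ⟩
    f 0 * g (suc k) + (conv (f ∘ suc) g k + x * conv f g k)
      ≡⟨ +-assoc (f 0 * g (suc k)) _ _ ⟨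
    f 0 * g (suc k) + conv (f ∘ suc) g k + x * conv f g k ∎

  -- 1 / (1 + x t) is the geometric series.
  conv-geometric : ∀ x f k → conv (mulLin x f) (λ j → (- x) ^ j) k ≡ f k
  conv-geometric x f k = trans (conv-mulLin x f geo k) (cancel k)
    where
    geo : ℕ → ℤ
    geo j = (- x) ^ j
    step : ∀ f k → conv f geo (suc k) ≡ f (suc k) - x * conv f geo k
    step f zero    = identity x (f 0) (f 1)
      where
      identity : ∀ x a b → a * (- x * 1ℤ) + b * 1ℤ ≡ b - x * (a * 1ℤ)
      identity = solve-∀
    step f (suc k) = begin
      f 0 * (- x * geo (suc k)) + conv (f ∘ suc) geo (suc k)
        ≡⟨ cong (_+_ (f 0 * (- x * geo (suc k)))) (step (f ∘ suc) k) ⟩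
      f 0 * (- x * geo (suc k)) + (f (suc (suc k)) - x * conv (f ∘ suc) geo k)
        ≡⟨ identity x (f 0) (geo (suc k)) (f (suc (suc k))) (conv (f ∘ suc) geo k) ⟩
      f (suc (suc k)) - x * (f 0 * geo (suc k) + conv (f ∘ suc) geo k) ∎
      where
      identity : ∀ x a g b d → a * (- x * g) + (b - x * d) ≡ b - x * (a * g + d)
      identity = solve-∀
    cancel : ∀ k → mulLin x (conv f geo) k ≡ f k
    cancel zero    = *-identityʳ (f 0)
    cancel (suc k) = trans (cong (_+ x * conv f geo k) (step f k)) (identity (f (suc k)) (x * conv f geo k))
      where
      identity : ∀ a b → a - b + b ≡ a
      identity = solve-∀

  E-+ : ∀ φ m n → E φ (m ℕ.+ n) ≗ conv (E (λ i → φ (m ℕ.+ i)) n) (E φ m)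
  E-+ φ m zero    k = trans (cong (λ l → E φ l k) (ℕ.+-identityʳ m)) (sym (conv-δ 0 (E φ m) k))
  E-+ φ m (suc n) k = begin
    E φ (m ℕ.+ suc n) k
      ≡⟨ cong (λ l → E φ l k) (ℕ.+-suc m n) ⟩
    mulLin (φ (m ℕ.+ n)) (E φ (m ℕ.+ n)) k
      ≡⟨ mulLin-cong refl (E-+ φ m n) k ⟩
    mulLin (φ (m ℕ.+ n)) (conv (E (λ i → φ (m ℕ.+ i)) n) (E φ m)) k
      ≡⟨ conv-mulLin (φ (m ℕ.+ n)) _ _ k ⟨
    conv (E (λ i → φ (m ℕ.+ i)) (suc n)) (E φ m) k ∎

  -- Induction on the number of factors. A new factor 1 + x t adds x / (1 + x t) to the logarithmic
  -- derivative, and `conv-geometric` cancels that denominator against the new factor of the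
  -- product.
  newton : ∀ φ n k → + suc k * E φ n (suc k) ≡ conv (E φ n) (λ j → -1ℤ ^ j * power-sum φ n (suc j)) k
  newton φ zero    k = begin
    + suc k * 0ℤ                                        ≡⟨ *-zeroʳ (+ suc k) ⟩
    0ℤ                                                  ≡⟨ conv-zeroʳ (δ 0) k ⟨
    conv (δ 0) (λ _ → 0ℤ) k                             ≡⟨ conv-cong (λ _ → refl) (λ j → sym (*-zeroʳ (-1ℤ ^ j))) k ⟩
    conv (δ 0) (λ j → -1ℤ ^ j * 0ℤ) k                   ∎
  newton φ (suc n) k = sym (begin
    conv (E φ (suc n)) (λ j → -1ℤ ^ j * (power-sum φ n (suc j) + x ^ suc j)) k
      ≡⟨ conv-cong (λ _ → refl) (λ j → split (power-sum φ n (suc j)) j) k ⟩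
    conv (E φ (suc n)) (λ j → h j + x * (- x) ^ j) k
      ≡⟨ conv-linearʳ x (E φ (suc n)) h (λ j → (- x) ^ j) k ⟩
    conv (E φ (suc n)) h k + x * conv (E φ (suc n)) (λ j → (- x) ^ j) k
      ≡⟨ cong₂ (λ a b → a + x * b) (conv-mulLin x (E φ n) h k) (conv-geometric x (E φ n) k) ⟩
    mulLin x (conv (E φ n) h) k + x * E φ n k
      ≡⟨ induct k ⟩
    + suc k * (E φ n (suc k) + x * E φ n k) ∎)
    where
    x : ℤ
    x = φ n
    h : ℕ → ℤ
    h j = -1ℤ ^ j * power-sum φ n (suc j)
    signs : ∀ j → -1ℤ ^ j * x ^ j ≡ (- x) ^ j
    signs zero    = refl
    signs (suc j) = trans (identity x (-1ℤ ^ j) (x ^ j)) (cong (- x *_) (signs j))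
      where
      identity : ∀ x s y → -1ℤ * s * (x * y) ≡ - x * (s * y)
      identity = solve-∀
    split : ∀ a j → -1ℤ ^ j * (a + x * x ^ j) ≡ -1ℤ ^ j * a + x * (- x) ^ j
    split a j = trans (identity x (-1ℤ ^ j) a (x ^ j)) (cong (λ y → -1ℤ ^ j * a + x * y) (signs j))
      where
      identity : ∀ x s a y → s * (a + x * y) ≡ s * a + x * (s * y)
      identity = solve-∀
    induct : ∀ k → mulLin x (conv (E φ n) h) k + x * E φ n k ≡ + suc k * (E φ n (suc k) + x * E φ n k)
    induct zero    = trans (cong (_+ x * E φ n 0) (sym (newton φ n 0))) (identity x (E φ n 1) (E φ n 0))
      where
      identity : ∀ x a b → 1ℤ * a + x * b ≡ 1ℤ * (a + x * b)
      identity = solve-∀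
    induct (suc k) = trans (cong₂ (λ a b → a + x * b + x * E φ n (suc k)) (sym (newton φ n (suc k)))
        (sym (newton φ n k)))
      (identity x (+ suc k) (E φ n (suc (suc k))) (E φ n (suc k)))
      where
      identity : ∀ x m a b → (1ℤ + m) * a + x * (m * b) + x * b ≡ (1ℤ + m) * (a + x * b)
      identity = solve-∀

-- Taylor expansion of a product under translation of its roots.

module Shift where
  open import Data.Nat as ℕ using (ℕ; zero; suc)
  open import Data.Integer hiding (suc)
  open import Data.Integer.Properties
  open import Data.Integer.Tactic.RingSolver using (solve-∀)
  open import Data.Product using (∃; _,_)
  open import Relation.Binary.PropositionalEquality
  open SymmetricFunctions

  -- Index 3 + k of pad f is index k of f, so that f may be read at k - 1, k - 2 and k - 3.
  pad : (ℕ → ℤ) → ℕ → ℤ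
  pad f 0                   = 0ℤ
  pad f 1                   = 0ℤ
  pad f 2                   = 0ℤ
  pad f (suc (suc (suc k))) = f k

  pad-mulLin : ∀ x f m → pad (mulLin x f) (suc m) ≡ pad f (suc m) + x * pad f m
  pad-mulLin x f 0                   = sym (trans (+-identityˡ _) (*-zeroʳ x))
  pad-mulLin x f 1                   = sym (trans (+-identityˡ _) (*-zeroʳ x))
  pad-mulLin x f 2                   = sym (trans (cong (_+_ (f 0)) (*-zeroʳ x)) (+-identityʳ (f 0)))
  pad-mulLin x f (suc (suc (suc m))) = refl

  -- With d = n - k, the coefficient of y^i is 3! times the binomial coefficient C(d + i, i).
  -- Writing these as polynomials in `d` covers k > n too, where d is negative.
  taylor₃ : (y d p₃ p₂ p₁ p₀ : ℤ) → ℤ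
  taylor₃ y d p₃ p₂ p₁ p₀ =
    + 6 * p₃ + + 6 * (d + + 1) * y * p₂ + + 3 * (d + + 2) * (d + + 1) * y * y * p₁
    + (d + + 3) * (d + + 2) * (d + + 1) * y * y * y * p₀

  -- Third order Taylor expansion in y of ∏ (1 + (y + φ i) t), multiplied by 3!.
  E-shift : ∀ φ y n k → ∃ λ Z →
    + 6 * E (λ i → y + φ i) n k ≡
    taylor₃ y (+ n - + k) (pad (E φ n) (3 ℕ.+ k)) (pad (E φ n) (2 ℕ.+ k)) (pad (E φ n) (1 ℕ.+ k)) (pad (E φ n) k)
    + y * y * y * y * Z
  E-shift φ y n zero = 0ℤ , trans (cong (+ 6 *_) (trans (E-0 (λ i → y + φ i) n) (sym (E-0 φ n))))
      (identity y (+ n - + 0) (E φ n 0))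
    where
    identity : ∀ y d a → + 6 * a ≡ + 6 * a + + 6 * (d + + 1) * y * 0ℤ + + 3 * (d + + 2) * (d + + 1) * y * y * 0ℤ
      + (d + + 3) * (d + + 2) * (d + + 1) * y * y * y * 0ℤ + y * y * y * y * 0ℤ
    identity = solve-∀
  -- For n = 0 and 1 ≤ k ≤ 3 the entry `δ 0 0` = 1 appears on the right, but its coefficient
  -- contains the factor d + k = 0.
  E-shift φ y zero 1 = 0ℤ , identity y
    where
    identity : ∀ y → + 6 * 0ℤ ≡ + 6 * 0ℤ + + 6 * (-[1+ 0 ] + + 1) * y * 1ℤ + + 3 * (-[1+ 0 ] + + 2) *
        (-[1+ 0 ] + + 1) * y * y * 0ℤ
      + (-[1+ 0 ] + + 3) * (-[1+ 0 ] + + 2) * (-[1+ 0 ] + + 1) * y * y * y * 0ℤ + y * y * y * y * 0ℤ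
    identity = solve-∀
  E-shift φ y zero 2 = 0ℤ , identity y
    where
    identity : ∀ y → + 6 * 0ℤ ≡ + 6 * 0ℤ + + 6 * (-[1+ 1 ] + + 1) * y * 0ℤ + + 3 * (-[1+ 1 ] + + 2) *
        (-[1+ 1 ] + + 1) * y * y * 1ℤ
      + (-[1+ 1 ] + + 3) * (-[1+ 1 ] + + 2) * (-[1+ 1 ] + + 1) * y * y * y * 0ℤ + y * y * y * y * 0ℤ
    identity = solve-∀
  E-shift φ y zero 3 = 0ℤ , identity y
    where
    identity : ∀ y → + 6 * 0ℤ ≡ + 6 * 0ℤ + + 6 * (-[1+ 2 ] + + 1) * y * 0ℤ + + 3 * (-[1+ 2 ] + + 2) *
        (-[1+ 2 ] + + 1) * y * y * 0ℤ
      + (-[1+ 2 ] + + 3) * (-[1+ 2 ] + + 2) * (-[1+ 2 ] + + 1) * y * y * y * 1ℤ + y * y * y * y * 0ℤ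
    identity = solve-∀
  E-shift φ y zero (suc (suc (suc (suc k)))) = 0ℤ , identity y (+ 0 - + (4 ℕ.+ k))
    where
    identity : ∀ y d → + 6 * 0ℤ ≡ + 6 * 0ℤ + + 6 * (d + + 1) * y * 0ℤ + + 3 * (d + + 2) * (d + + 1) * y * y * 0ℤ
      + (d + + 3) * (d + + 2) * (d + + 1) * y * y * y * 0ℤ + y * y * y * y * 0ℤ
    identity = solve-∀
  E-shift φ y (suc n) (suc k) with E-shift φ y n (suc k) | E-shift φ y n k
  ... | Z₁ , eq₁ | Z₀ , eq₀ = _ , (begin
    + 6 * (E ψ n (suc k) + (y + x) * E ψ n k)
      ≡⟨ distribute (E ψ n (suc k)) (y + x) (E ψ n k) ⟩
    + 6 * E ψ n (suc k) + (y + x) * (+ 6 * E ψ n k)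
      ≡⟨ cong₂ (λ a b → a + (y + x) * b) eq₁ eq₀ ⟩
    taylor₃ y (N - (1ℤ + K)) (P (4 ℕ.+ k)) (P (3 ℕ.+ k)) (P (2 ℕ.+ k)) (P (1 ℕ.+ k)) + y * y * y * y * Z₁
    + (y + x) * (taylor₃ y (N - K) (P (3 ℕ.+ k)) (P (2 ℕ.+ k)) (P (1 ℕ.+ k)) (P k) + y * y * y * y * Z₀)
      -- The new remainder collects the two old ones and y times the cubic term of the expansion at
      -- index k.
      ≡⟨ identity x y N K (P (4 ℕ.+ k)) (P (3 ℕ.+ k)) (P (2 ℕ.+ k)) (P (1 ℕ.+ k)) (P k) Z₁ Z₀ ⟩
    taylor₃ y (1ℤ + N - (1ℤ + K)) (P (4 ℕ.+ k) + x * P (3 ℕ.+ k)) (P (3 ℕ.+ k) + x * P (2 ℕ.+ k))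
        (P (2 ℕ.+ k) + x * P (1 ℕ.+ k)) (P (1 ℕ.+ k) + x * P k)
    + y * y * y * y * (Z₁ + (y + x) * Z₀ + (N - K + + 3) * (N - K + + 2) * (N - K + + 1) * P k)
      ≡⟨ cong (_+ y * y * y * y * (Z₁ + (y + x) * Z₀ + (N - K + + 3) * (N - K + + 2) * (N - K + + 1) * P k))
           (fold (1ℤ + N - (1ℤ + K)) (P (4 ℕ.+ k) + x * P (3 ℕ.+ k))
             (pad-mulLin x (E φ n) (2 ℕ.+ k)) (pad-mulLin x (E φ n) (1 ℕ.+ k)) (pad-mulLin x (E φ n) k)) ⟩
    taylor₃ y (1ℤ + N - (1ℤ + K)) (P (4 ℕ.+ k) + x * P (3 ℕ.+ k)) (P′ (3 ℕ.+ k)) (P′ (2 ℕ.+ k)) (P′ (1 ℕ.+ k))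
    + y * y * y * y * (Z₁ + (y + x) * Z₀ + (N - K + + 3) * (N - K + + 2) * (N - K + + 1) * P k) ∎)
    where
    open ≡-Reasoning
    ψ : ℕ → ℤ
    ψ i = y + φ i
    x N K : ℤ
    x = φ n
    N = + n
    K = + k
    P P′ : ℕ → ℤ
    P  = pad (E φ n)
    P′ = pad (E φ (suc n))
    distribute : ∀ a b c → + 6 * (a + b * c) ≡ + 6 * a + b * (+ 6 * c)
    distribute = solve-∀
    fold : ∀ d p {p₂ p₁ p₀ q₂ q₁ q₀} → p₂ ≡ q₂ → p₁ ≡ q₁ → p₀ ≡ q₀ → taylor₃ y d p q₂ q₁ q₀ ≡ taylor₃ y d p p₂ p₁ p₀
    fold d p refl refl refl = refl
    identity : ∀ x y N K p₄ p₃ p₂ p₁ p₀ Z₁ Z₀ →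
      + 6 * p₄ + + 6 * (N - (1ℤ + K) + + 1) * y * p₃ + + 3 * (N - (1ℤ + K) + + 2) * (N - (1ℤ + K) + + 1) * y * y * p₂
      + (N - (1ℤ + K) + + 3) * (N - (1ℤ + K) + + 2) * (N - (1ℤ + K) + + 1) * y * y * y * p₁ + y * y * y * y * Z₁
      + (y + x) * (+ 6 * p₃ + + 6 * (N - K + + 1) * y * p₂ + + 3 * (N - K + + 2) * (N - K + + 1) * y * y * p₁
      + (N - K + + 3) * (N - K + + 2) * (N - K + + 1) * y * y * y * p₀ + y * y * y * y * Z₀)
      ≡
      + 6 * (p₄ + x * p₃) + + 6 * (1ℤ + N - (1ℤ + K) + + 1) * y * (p₃ + x * p₂)
      + + 3 * (1ℤ + N - (1ℤ + K) + + 2) * (1ℤ + N - (1ℤ + K) + + 1) * y * y * (p₂ + x * p₁)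
      + (1ℤ + N - (1ℤ + K) + + 3) * (1ℤ + N - (1ℤ + K) + + 2) * (1ℤ + N - (1ℤ + K) + + 1) * y * y * y * (p₁ + x * p₀)
      + y * y * y * y * (Z₁ + (y + x) * Z₀ + (N - K + + 3) * (N - K + + 2) * (N - K + + 1) * p₀)
    identity = solve-∀

  -- First order is enough when y is a multiple of p and the modulus is p or p². The 6 is left over
  -- from 3!.
  E-shift₁ : ∀ φ y n k → ∃ λ W →
    + 6 * (E (λ i → y + φ i) n k - E φ n k) ≡ y * (+ 6 * (+ n - + k + + 1) * pad (E φ n) (2 ℕ.+ k)) + y * y * W
  E-shift₁ φ y n k with E-shift φ y n k
  ... | Z , eq = _ , trans (distribute (E (λ i → y + φ i) n k) (E φ n k))
    (trans (cong (_- + 6 * E φ n k) eq)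
      (identity y (+ n - + k) (E φ n k) (pad (E φ n) (2 ℕ.+ k)) (pad (E φ n) (1 ℕ.+ k)) (pad (E φ n) k) Z))
    where
    distribute : ∀ a b → + 6 * (a - b) ≡ + 6 * a - + 6 * b
    distribute = solve-∀
    identity : ∀ y d p₃ p₂ p₁ p₀ Z → + 6 * p₃ + + 6 * (d + + 1) * y * p₂ + + 3 * (d + + 2) * (d + + 1) * y * y * p₁
      + (d + + 3) * (d + + 2) * (d + + 1) * y * y * y * p₀ + y * y * y * y * Z - + 6 * p₃
      ≡ y * (+ 6 * (d + + 1) * p₂)
      + y * y * (+ 3 * (d + + 2) * (d + + 1) * p₁ + (d + + 3) * (d + + 2) * (d + + 1) * y * p₀ + y * y * Z)
    identity = solve-∀

-- Divisibility in ℤ by powers of a prime, and congruences of convolutions.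

module IntegerDivisibility where
  open import Data.Nat as ℕ using (ℕ; zero; suc)
  import Data.Nat.Properties as ℕ
  import Data.Nat.Divisibility as ℕ
  open import Data.Nat.Primality using (Prime; euclidsLemma; prime⇒nonZero)
  open import Data.Integer hiding (suc)
  open import Data.Integer.Properties
  open import Data.Integer.Divisibility.Signed
  open import Data.Integer.Tactic.RingSolver using (solve-∀)
  open import Data.Sum using (_⊎_; inj₁; inj₂) renaming (map to ⊎-map)
  open import Data.Empty using (⊥-elim)
  open import Function using (_∘_)
  open import Relation.Nullary using (¬_)
  open import Relation.Binary.PropositionalEquality
  open SymmetricFunctions

  ∣0 : ∀ {m} → m ∣ 0ℤ
  ∣0 {m} = divides 0ℤ (sym (*-zeroˡ m))

  *-∣-* : ∀ {a b c d} → a ∣ b → c ∣ d → a * c ∣ b * d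
  *-∣-* {a} {b} {c} {d} (divides x refl) (divides y refl) = divides (x * y) (identity x a y c)
    where
    identity : ∀ x a y c → x * a * (y * c) ≡ x * y * (a * c)
    identity = solve-∀

  ∣-resp-+ : ∀ {m a b} → m ∣ a - b → m ∣ b → m ∣ a
  ∣-resp-+ {m} {a} {b} d e = subst (m ∣_) (identity a b) (∣m∣n⇒∣m+n d e)
    where
    identity : ∀ a b → a - b + b ≡ a
    identity = solve-∀

  ∣-resp-+′ : ∀ {m a b} → m ∣ a - b → m ∣ a → m ∣ b
  ∣-resp-+′ {m} {a} {b} d e = subst (m ∣_) (identity a b) (∣m∣n⇒∣m-n e d)
    where
    identity : ∀ a b → a - (a - b) ≡ b
    identity = solve-∀

  ∣-resp-trans : ∀ {m a b c} → m ∣ a - b → m ∣ b - c → m ∣ a - c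
  ∣-resp-trans {m} {a} {b} {c} d e = subst (m ∣_) (identity a b c) (∣m∣n⇒∣m+n d e)
    where
    identity : ∀ a b c → (a - b) + (b - c) ≡ a - c
    identity = solve-∀

  ∣-reflexive-diff : ∀ {m a b} → a ≡ b → m ∣ a - b
  ∣-reflexive-diff {m} {a} refl = subst (m ∣_) (sym (+-inverseʳ a)) ∣0

  ^-monoʳ-∣ : ∀ m {i j} → i ℕ.≤ j → m ^ i ∣ m ^ j
  ^-monoʳ-∣ m {zero}  {j}     _          = divides (m ^ j) (sym (*-identityʳ (m ^ j)))
  ^-monoʳ-∣ m {suc i} {suc j} (ℕ.s≤s le) = *-monoʳ-∣ m (^-monoʳ-∣ m le)

  pos-∤ : ∀ {p c} → 0 ℕ.< c → c ℕ.< p → ¬ (+ p ∣ + c)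
  pos-∤ {p} {c} 0<c c<p d = ℕ.<⇒≱ c<p (ℕ.∣⇒≤ {{ℕ.>-nonZero 0<c}} (∣⇒∣ᵤ d))

  module _ {p} (pp : Prime p) where
    prime-∣-* : ∀ a b → + p ∣ a * b → (+ p ∣ a) ⊎ (+ p ∣ b)
    prime-∣-* a b d = ⊎-map ∣ᵤ⇒∣ ∣ᵤ⇒∣ (euclidsLemma ∣ a ∣ ∣ b ∣ pp (subst (p ℕ.∣_) (abs-* a b) (∣⇒∣ᵤ d)))

    prime-∤-* : ∀ {a b} → ¬ (+ p ∣ a) → ¬ (+ p ∣ b) → ¬ (+ p ∣ a * b)
    prime-∤-* {a} {b} na nb d with prime-∣-* a b d
    ... | inj₁ e = na e
    ... | inj₂ e = nb e

    -- One p at a time: Euclid's lemma moves it from `c * x` into `x`, and it cancels on both sides.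
    cancel-unit : ∀ e {c x} → ¬ (+ p ∣ c) → (+ p) ^ e ∣ c * x → (+ p) ^ e ∣ x
    cancel-unit zero    {c} {x} p∤c d = divides x (sym (*-identityʳ x))
    cancel-unit (suc e) {c} {x} p∤c d with prime-∣-* c x (∣-trans (∣m⇒∣m*n _ ∣-refl) d)
    ... | inj₁ p∣c = ⊥-elim (p∤c p∣c)
    ... | inj₂ (divides y refl) = subst (+ p * (+ p) ^ e ∣_) (*-comm (+ p) y)
      (*-monoʳ-∣ (+ p) (cancel-unit e p∤c
          (*-cancelˡ-∣ (+ p) {{ℕ≢0}} (subst (+ p * (+ p) ^ e ∣_) (identity c y (+ p)) d))))
      where
      ℕ≢0 : NonZero (+ p)
      ℕ≢0 = prime⇒nonZero pp
      identity : ∀ c y p → c * (y * p) ≡ p * (c * y)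
      identity = solve-∀

  conv-∣ : ∀ {m} f g k → (∀ i j → i ℕ.+ j ≡ k → m ∣ f i * g j) → m ∣ conv f g k
  conv-∣ f g zero    h = h 0 0 refl
  conv-∣ f g (suc k) h = ∣m∣n⇒∣m+n (h 0 (suc k) refl) (conv-∣ (f ∘ suc) g k (λ i j eq → h (suc i) j (cong suc eq)))

  -- The hypothesis is about products, so an error divisible by p alone is allowed where the
  -- cofactor supplies a second p. This is how congruences modulo p² are reached.
  conv-approx : ∀ {m} f f′ g k → (∀ i j → i ℕ.+ j ≡ k → m ∣ (f i - f′ i) * g j) → m ∣ conv f g k - conv f′ g k
  conv-approx {m} f f′ g k h = subst (m ∣_) eq (conv-∣ (λ i → f i + -1ℤ * f′ i) g k
      (λ i j i+j≡k → subst (λ a → m ∣ a * g j) (identity (f i) (f′ i)) (h i j i+j≡k)))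
    where
    identity : ∀ a b → a - b ≡ a + -1ℤ * b
    identity = solve-∀
    eq : conv (λ i → f i + -1ℤ * f′ i) g k ≡ conv f g k - conv f′ g k
    eq = trans (conv-linearˡ -1ℤ f f′ g k) (sym (identity (conv f g k) (conv f′ g k)))

  mulLin-∣ : ∀ {m} x {f g} → (∀ j → m ∣ f j - g j) → ∀ j → m ∣ mulLin x f j - mulLin x g j
  mulLin-∣ {m} x         h zero    = h zero
  mulLin-∣ {m} x {f} {g} h (suc j) = subst (m ∣_) (identity x (f (suc j)) (g (suc j)) (f j) (g j))
    (∣m∣n⇒∣m+n (h (suc j)) (∣n⇒∣m*n x (h j)))
    where
    identity : ∀ x a b c d → a - b + x * (c - d) ≡ a + x * c - (b + x * d)
    identity = solve-∀

  neg1-even : ∀ m → -1ℤ ^ (m ℕ.* 2) ≡ 1ℤ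
  neg1-even zero    = refl
  neg1-even (suc m) = trans (identity (-1ℤ ^ (m ℕ.* 2))) (neg1-even m)
    where
    identity : ∀ a → -1ℤ * (-1ℤ * a) ≡ a
    identity = solve-∀

-- Arithmetic in ℚ and the embedding of ℤ.

module RationalRing where
  open import Data.Rational using (0ℚ)
  open import Data.Rational.Properties using (+-*-commutativeRing; _≟_)
  open import Tactic.RingSolver.Core.AlmostCommutativeRing using (AlmostCommutativeRing; fromCommutativeRing)
  open import Relation.Nullary.Decidable using (dec⇒maybe)
  open import Level using (0ℓ)

  ℚ-ring : AlmostCommutativeRing 0ℓ 0ℓ
  ℚ-ring = fromCommutativeRing +-*-commutativeRing (λ x → dec⇒maybe (0ℚ ≟ x))

module Embedding where
  open import Data.Nat using (suc)
  open import Data.Integer as ℤ using (ℤ; +_)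
  import Data.Integer.Properties as ℤ
  open import Data.Integer.Tactic.RingSolver using (solve-∀)
  open import Data.Rational
  open import Data.Rational.Properties
  open import Data.Rational.Unnormalised as ℚᵘ using (mkℚᵘ; *≡*)
  import Data.Rational.Unnormalised.Properties as ℚᵘ
  open import Relation.Binary.PropositionalEquality

  abstract
    -- Opaque outside this block: later arguments use the homomorphism laws and never compute with
    -- normalised fractions.
    ι : ℤ → ℚ
    ι z = z / 1

    ι-/1 : ∀ z → z / 1 ≡ ι z
    ι-/1 z = refl

    ι-0 : ι (+ 0) ≡ 0ℚ
    ι-0 = refl

    ι-1 : ι (+ 1) ≡ 1ℚ
    ι-1 = refl

    private
      toℚᵘ-ι : ∀ z → toℚᵘ (ι z) ℚᵘ.≃ mkℚᵘ z 0
      toℚᵘ-ι z = toℚᵘ-fromℚᵘ (mkℚᵘ z 0)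

    ι-+ : ∀ a b → ι (a ℤ.+ b) ≡ ι a + ι b
    ι-+ a b = toℚᵘ-injective (ℚᵘ.≃-trans (toℚᵘ-ι (a ℤ.+ b)) (ℚᵘ.≃-trans (*≡* (identity a b)) (ℚᵘ.≃-sym
      (ℚᵘ.≃-trans (toℚᵘ-homo-+ (ι a) (ι b)) (ℚᵘ.+-cong (toℚᵘ-ι a) (toℚᵘ-ι b))))))
      where
      identity : ∀ a b → (a ℤ.+ b) ℤ.* + 1 ≡ (a ℤ.* + 1 ℤ.+ b ℤ.* + 1) ℤ.* + 1
      identity = solve-∀

    ι-* : ∀ a b → ι (a ℤ.* b) ≡ ι a * ι b
    ι-* a b = toℚᵘ-injective (ℚᵘ.≃-trans (toℚᵘ-ι (a ℤ.* b)) (ℚᵘ.≃-sym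
      (ℚᵘ.≃-trans (toℚᵘ-homo-* (ι a) (ι b)) (ℚᵘ.*-cong (toℚᵘ-ι a) (toℚᵘ-ι b)))))

    ι-injective : ∀ {a b} → ι a ≡ ι b → a ≡ b
    ι-injective {a} {b} eq with fromℚᵘ-injective {mkℚᵘ a 0} {mkℚᵘ b 0} eq
    ... | *≡* eq′ = trans (sym (ℤ.*-identityʳ a)) (trans eq′ (ℤ.*-identityʳ b))

    ι-numerator : ∀ x → x * ι (↧ x) ≡ ι (↥ x)
    ι-numerator x = toℚᵘ-injective (ℚᵘ.≃-trans (toℚᵘ-homo-* x (ι (↧ x)))
      (ℚᵘ.≃-trans (ℚᵘ.*-cong (ℚᵘ.≃-refl {toℚᵘ x}) (toℚᵘ-ι (↧ x))) (ℚᵘ.≃-trans (lowest x) (ℚᵘ.≃-sym (toℚᵘ-ι (↥ x))))))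
      where
      identity : ∀ n d → n ℤ.* d ℤ.* + 1 ≡ n ℤ.* (d ℤ.* + 1)
      identity = solve-∀
      lowest : ∀ x → toℚᵘ x ℚᵘ.* mkℚᵘ (↧ x) 0 ℚᵘ.≃ mkℚᵘ (↥ x) 0
      lowest (mkℚ n d-1 _) = *≡* (trans (identity n (+ suc d-1)) (cong (n ℤ.*_) (sym (ℤ.pos-* (suc d-1) 1))))

    ι-inverse : ∀ n x → ι (+ suc n) * (+ 1 / suc n * x) ≡ x
    ι-inverse n x = trans (sym (*-assoc (ι (+ suc n)) (+ 1 / suc n) x)) (trans (cong (_* x) inverse) (*-identityˡ x))
      where
      inverse : ι (+ suc n) * (+ 1 / suc n) ≡ 1ℚ
      inverse = toℚᵘ-injective (ℚᵘ.≃-trans (toℚᵘ-homo-* (ι (+ suc n)) (+ 1 / suc n))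
        (ℚᵘ.≃-trans (ℚᵘ.*-cong (toℚᵘ-ι (+ suc n)) (toℚᵘ-fromℚᵘ (mkℚᵘ (+ 1) n))) (*≡* (identity (+ suc n)))))
        where
        identity : ∀ a → a ℤ.* + 1 ℤ.* + 1 ≡ + 1 ℤ.* (+ 1 ℤ.* a)
        identity = solve-∀

  ι-neg : ∀ a → ι (ℤ.- a) ≡ - ι a
  ι-neg a = trans (sym (+-identityʳ _)) (trans (cong (_+_ (ι (ℤ.- a))) (sym (+-inverseʳ (ι a))))
    (trans (sym (+-assoc (ι (ℤ.- a)) (ι a) (- ι a)))
      (trans (cong (_- ι a) (trans (sym (ι-+ (ℤ.- a) a)) (trans (cong ι (ℤ.+-inverseˡ a)) ι-0)))
          (+-identityˡ (- ι a)))))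

  ι-suc : ∀ m → ι (+ suc m) ≡ 1ℚ + ι (+ m)
  ι-suc m = trans (ι-+ (+ 1) (+ m)) (cong (_+ ι (+ m)) ι-1)

-- The binomial transform and its inversion.

module BinomialTransform where
  open import Data.Nat as ℕ using (ℕ; zero; suc)
  import Data.Nat.Properties as ℕ
  open import Data.Nat.Combinatorics using (_C_; nCk+nC[k+1]≡[n+1]C[k+1]; k>n⇒nCk≡0; nCn≡1)
  open import Data.Integer using (+_)
  open import Data.Rational
  open import Data.Rational.Properties
  open import Tactic.RingSolver using (solve-∀)
  open import Function using (_∘_)
  open import Relation.Binary.PropositionalEquality
  open RationalRing
  open Embedding

  -- The sum of C(n, j) X_j over j ≤ n, umbrally (1 + X)^n. Pascal's rule is built into the
  -- recursion, so that inductions meet no binomial coefficients.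
  T : (ℕ → ℚ) → ℕ → ℚ
  T X zero    = X 0
  T X (suc n) = T (λ j → X j + X (suc j)) n

  T-cong : ∀ {X Y} → (∀ j → X j ≡ Y j) → ∀ n → T X n ≡ T Y n
  T-cong h zero    = h 0
  T-cong h (suc n) = T-cong (λ j → cong₂ _+_ (h j) (h (suc j))) n

  T-linear : ∀ c X Y n → T (λ j → X j + c * Y j) n ≡ T X n + c * T Y n
  T-linear c X Y zero    = refl
  T-linear c X Y (suc n) = trans (T-cong (λ j → identity c (X j) (X (suc j)) (Y j) (Y (suc j))) n)
                                 (T-linear c (λ j → X j + X (suc j)) (λ j → Y j + Y (suc j)) n)
    where
    identity : ∀ c a b a′ b′ → (a + c * a′) + (b + c * b′) ≡ (a + b) + c * (a′ + b′)
    identity = solve-∀ ℚ-ring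

  T-+ : ∀ X Y n → T (λ j → X j + Y j) n ≡ T X n + T Y n
  T-+ X Y n = trans (T-cong (λ j → cong (_+_ (X j)) (sym (*-identityˡ (Y j)))) n)
    (trans (T-linear 1ℚ X Y n) (cong (_+_ (T X n)) (*-identityˡ (T Y n))))

  -- The value is (-1)^n X_n.
  alt : (ℕ → ℚ) → ℕ → ℚ
  alt X zero    = X 0
  alt X (suc n) = - alt (X ∘ suc) n

  alt-cong : ∀ {X Y} → (∀ j → X j ≡ Y j) → ∀ n → alt X n ≡ alt Y n
  alt-cong h zero    = h 0
  alt-cong h (suc n) = cong -_ (alt-cong (h ∘ suc) n)

  alt-+ : ∀ X Y n → alt (λ j → X j + Y j) n ≡ alt X n + alt Y n
  alt-+ X Y zero    = refl
  alt-+ X Y (suc n) = trans (cong -_ (alt-+ (X ∘ suc) (Y ∘ suc) n))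
      (neg-distrib-+ (alt (X ∘ suc) n) (alt (Y ∘ suc) n))

  -- Binomial inversion. Since T X (j + 1) = T X j + T (X ∘ suc) j, one step of the outer transform
  -- turns `alt (T X)` into the negative of `alt (T (X ∘ suc))`, and the induction continues with
  -- the shifted sequence.
  T-alt-T : ∀ X n → T (alt (T X)) n ≡ alt X n
  T-alt-T X zero    = refl
  T-alt-T X (suc n) = trans (T-cong (λ j → shift j) n)
      (trans (T-linear (- 1ℚ) (λ _ → 0ℚ) (alt (T (X ∘ suc))) n)
        (trans (cong₂ (λ a b → a + - 1ℚ * b) (T-0 n) (T-alt-T (X ∘ suc) n)) (identity′ (alt (X ∘ suc) n))))
    where
    T-0 : ∀ n → T (λ _ → 0ℚ) n ≡ 0ℚ
    T-0 zero    = refl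
    T-0 (suc n) = T-0 n
    identity : ∀ a b → a + - (a + b) ≡ 0ℚ + - 1ℚ * b
    identity = solve-∀ ℚ-ring
    identity′ : ∀ a → 0ℚ + - 1ℚ * a ≡ - a
    identity′ = solve-∀ ℚ-ring
    shift : ∀ j → alt (T X) j + - alt (T X ∘ suc) j ≡ 0ℚ + - 1ℚ * alt (T (X ∘ suc)) j
    shift j = trans (cong (λ a → alt (T X) j + - a)
                (trans (alt-cong (T-+ X (X ∘ suc)) j) (alt-+ (T X) (T (X ∘ suc)) j)))
              (identity (alt (T X) j) (alt (T (X ∘ suc)) j))

  Σ< : ℕ → (ℕ → ℚ) → ℚ
  Σ< zero    f = 0ℚ
  Σ< (suc n) f = f 0 + Σ< n (f ∘ suc)

  Σ<-cong : ∀ n {f g} → (∀ j → f j ≡ g j) → Σ< n f ≡ Σ< n g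
  Σ<-cong zero    h = refl
  Σ<-cong (suc n) h = cong₂ _+_ (h 0) (Σ<-cong n (h ∘ suc))

  Σ<-+ : ∀ n f g → Σ< n (λ j → f j + g j) ≡ Σ< n f + Σ< n g
  Σ<-+ zero    f g = refl
  Σ<-+ (suc n) f g = trans (cong (_+_ (f 0 + g 0)) (Σ<-+ n (f ∘ suc) (g ∘ suc)))
      (identity (f 0) (g 0) (Σ< n (f ∘ suc)) (Σ< n (g ∘ suc)))
    where
    identity : ∀ a b c d → (a + b) + (c + d) ≡ (a + c) + (b + d)
    identity = solve-∀ ℚ-ring

  Σ<-last : ∀ n f → Σ< (suc n) f ≡ Σ< n f + f n
  Σ<-last zero    f = trans (+-identityʳ (f 0)) (sym (+-identityˡ (f 0)))
  Σ<-last (suc n) f = trans (cong (_+_ (f 0)) (Σ<-last n (f ∘ suc)))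
      (sym (+-assoc (f 0) (Σ< n (f ∘ suc)) (f (suc n))))

  nC0≡1 : ∀ n → n C 0 ≡ 1
  nC0≡1 zero    = nCn≡1 0
  nC0≡1 (suc n) = refl

  binomial-sum : ℕ → (ℕ → ℚ) → ℕ → ℚ
  binomial-sum n X m = Σ< m (λ j → ι (+ (n C j)) * X j)

  T-binomial : ∀ X n → T X n ≡ binomial-sum n X (suc n)
  T-binomial X zero    = sym (trans (+-identityʳ _) (trans (cong (λ c → ι (+ c) * X 0) (nC0≡1 0))
      (trans (cong (_* X 0) ι-1) (*-identityˡ (X 0)))))
  T-binomial X (suc n) = begin
    T (λ j → X j + X (suc j)) n
      ≡⟨ T-binomial (λ j → X j + X (suc j)) n ⟩
    Σ< (suc n) (λ j → c j * (X j + X (suc j)))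
      ≡⟨ trans (Σ<-cong (suc n) (λ j → *-distribˡ-+ (c j) (X j) (X (suc j))))
          (Σ<-+ (suc n) (λ j → c j * X j) (λ j → c j * X (suc j))) ⟩
    Σ< (suc n) (λ j → c j * X j) + Σ< (suc n) (λ j → c j * X (suc j))
      ≡⟨ cong (_+ Σ< (suc n) (λ j → c j * X (suc j))) pad-last ⟩
    c 0 * X 0 + Σ< (suc n) (λ j → c (suc j) * X (suc j)) + Σ< (suc n) (λ j → c j * X (suc j))
      ≡⟨ identity (c 0 * X 0) (Σ< (suc n) (λ j → c (suc j) * X (suc j))) (Σ< (suc n) (λ j → c j * X (suc j))) ⟩
    c 0 * X 0 + (Σ< (suc n) (λ j → c j * X (suc j)) + Σ< (suc n) (λ j → c (suc j) * X (suc j)))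
      ≡⟨ cong (_+_ (c 0 * X 0)) (Σ<-+ (suc n) (λ j → c j * X (suc j)) (λ j → c (suc j) * X (suc j))) ⟨
    c 0 * X 0 + Σ< (suc n) (λ j → c j * X (suc j) + c (suc j) * X (suc j))
      ≡⟨ cong₂ _+_ (cong (λ m → ι (+ m) * X 0) (trans (nC0≡1 n) (sym (nC0≡1 (suc n))))) (Σ<-cong (suc n) pascal) ⟩
    binomial-sum (suc n) X (suc (suc n)) ∎
    where
    open ≡-Reasoning
    c : ℕ → ℚ
    c j = ι (+ (n C j))
    identity : ∀ a b d → a + b + d ≡ a + (d + b)
    identity = solve-∀ ℚ-ring
    pascal : ∀ j → c j * X (suc j) + c (suc j) * X (suc j) ≡ ι (+ (suc n C suc j)) * X (suc j)
    pascal j = trans (sym (*-distribʳ-+ (X (suc j)) (c j) (c (suc j))))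
      (cong (_* X (suc j)) (trans (sym (ι-+ (+ (n C j)) (+ (n C suc j))))
          (cong (λ m → ι (+ m)) (nCk+nC[k+1]≡[n+1]C[k+1] n j))))
    -- C(n, n + 1) = 0 extends the shifted sum by one index, so that Pascal's rule applies term by
    -- term.
    pad-last : Σ< (suc n) (λ j → c j * X j) ≡ c 0 * X 0 + Σ< (suc n) (λ j → c (suc j) * X (suc j))
    pad-last = cong (_+_ (c 0 * X 0)) (sym (trans (Σ<-last n (λ j → c (suc j) * X (suc j)))
      (trans (cong (λ m → Σ< n (λ j → c (suc j) * X (suc j)) + ι (+ m) * X (suc n)) (k>n⇒nCk≡0 (ℕ.n<1+n n)))
        (trans (cong (λ a → Σ< n (λ j → c (suc j) * X (suc j)) + a)
            (trans (cong (_* X (suc n)) ι-0) (*-zeroˡ (X (suc n)))))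
          (+-identityʳ _)))))

  -- `Φ x` plays the role of the congruence x ≡ 0. The instances are `_≡ 0ℚ` and `D e`.
  record Additive (Φ : ℚ → Set) : Set where
    field
      0-closed : Φ 0ℚ
      +-closed : ∀ {x y} → Φ x → Φ y → Φ (x + y)

  module _ {Φ : ℚ → Set} (additive : Additive Φ) where
    open Additive additive

    T-top : ∀ X m → (∀ j → j ℕ.< m → Φ (X j)) → Φ (T X m - X m)
    T-top X zero    h = subst Φ (sym (+-inverseʳ (X 0))) 0-closed
    T-top X (suc m) h = subst Φ (identity (T (λ j → X j + X (suc j)) m) (X m) (X (suc m)))
        (+-closed (T-top (λ j → X j + X (suc j)) m (λ j j<m → +-closed (h j (ℕ.m<n⇒m<1+n j<m))
            (h (suc j) (ℕ.s≤s j<m)))) (h m (ℕ.n<1+n m)))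
      where
      identity : ∀ a b c → a - (b + c) + b ≡ a - c
      identity = solve-∀ ℚ-ring

    -- The last two entries in row m + 1 of Pascal's triangle are m + 1 and 1. Additivity of Φ
    -- carries the hypothesis over to the sequence X_j + X_{j+1}.
    T-top₂ : ∀ X m → (∀ j → j ℕ.< m → Φ (X j)) → Φ (T X (suc m) - X (suc m) - ι (+ suc m) * X m)
    T-top₂ X zero    h = subst Φ (trans (identity (X 0) (X 1)) (cong (λ a → X 0 + X 1 - X 1 - a * X 0)
        (sym ι-1))) 0-closed
      where
      identity : ∀ a b → 0ℚ ≡ a + b - b - 1ℚ * a
      identity = solve-∀ ℚ-ring
    T-top₂ X (suc m) h = subst Φ
        (trans (identity (T (λ j → X j + X (suc j)) (suc m)) (X m) (X (suc m)) (X (suc (suc m))) (ι (+ m)))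
               (sym (cong (λ a → T X (suc (suc m)) - X (suc (suc m)) - a * X (suc m))
                   (trans (ι-suc (suc m)) (cong (_+_ 1ℚ) (ι-suc m))))))
        (+-closed (subst (λ a → Φ (T (λ j → X j + X (suc j)) (suc m) - (X (suc m) + X (suc (suc m))) - a *
            (X m + X (suc m)))) (ι-suc m)
                     (T-top₂ (λ j → X j + X (suc j)) m (λ j j<m → +-closed (h j (ℕ.m<n⇒m<1+n j<m))
                         (h (suc j) (ℕ.s≤s j<m)))))
                  (subst (λ a → Φ (a * X m)) (ι-suc m) (multiple (suc m))))
      where
      multiple : ∀ i → Φ (ι (+ i) * X m)
      multiple zero    = subst Φ (sym (trans (cong (_* X m) ι-0) (*-zeroˡ (X m)))) 0-closed
      multiple (suc i) = subst Φ (trans (distribute (X m) (ι (+ i))) (cong (_* X m) (sym (ι-suc i))))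
          (+-closed (h m (ℕ.n<1+n m)) (multiple i))
        where
        distribute : ∀ x i → x + i * x ≡ (1ℚ + i) * x
        distribute = solve-∀ ℚ-ring
      identity : ∀ t a b c i → t - (b + c) - (1ℚ + i) * (a + b) + (1ℚ + i) * a ≡ t - c - (1ℚ + (1ℚ + i)) * b
      identity = solve-∀ ℚ-ring

-- Correctness of the fuel-bounded valuation `vp`.

module Valuation where
  open import Defs using (vp; vpAux)
  open import Data.Nat
  open import Data.Nat.Properties
  open import Data.Nat.Divisibility
  open import Data.Nat.DivMod using (m/n<m; m*n/n≡m)
  open import Data.Empty using (⊥-elim)
  open import Relation.Nullary using (¬_; yes; no)
  open import Relation.Binary.PropositionalEquality

  module _ (q : ℕ) (0<q : 0 < q) where
    private
      p : ℕ
      p = suc q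

      quotient-≤ : ∀ {f m} → suc m ≤ suc f → suc m / p ≤ f
      quotient-≤ {f} {m} m≤f = s≤s⁻¹ (≤-trans (m/n<m (suc m) p (s≤s 0<q)) m≤f)

      quotient-pos : ∀ m → p ∣ suc m → 0 < suc m / p
      quotient-pos m (divides (suc c) eq) = subst (λ n → 0 < n / p) (sym eq)
          (subst (0 <_) (sym (m*n/n≡m (suc c) p)) z<s)

      ∣-quotient : ∀ r m → p ^ suc r ∣ suc m → p ^ r ∣ suc m / p
      ∣-quotient r m (divides c eq) = divides c
          (trans (cong (_/ p) (trans eq (trans (cong (c *_) (*-comm p (p ^ r))) (sym (*-assoc c (p ^ r) p)))))
          (m*n/n≡m (c * p ^ r) p))

      -- Division by p ≥ 2 makes n strictly smaller, so the invariant `n ≤ f` survives each step and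
      -- the fuel lasts as long as p divides.
      aux-lower : ∀ f n r → n ≤ f → 0 < n → p ^ r ∣ n → r ≤ vpAux f p n
      aux-lower (suc f) (suc m) zero    n≤f 0<n d = z≤n
      aux-lower (suc f) (suc m) (suc r) n≤f 0<n d with p ∣? suc m
      ... | yes p∣n = s≤s (aux-lower f (suc m / p) r (quotient-≤ n≤f) (quotient-pos m p∣n) (∣-quotient r m d))
      ... | no  p∤n = ⊥-elim (p∤n (∣-trans (m∣m*n (p ^ r)) d))

      aux-divides : ∀ f n → n ≤ f → 0 < n → p ^ vpAux f p n ∣ n
      aux-divides (suc f) (suc m) n≤f 0<n with p ∣? suc m
      ... | no  p∤n = 1∣ suc m
      ... | yes p∣n@(divides c eq) = subst (p ^ suc (vpAux f p (suc m / p)) ∣_)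
          (trans (cong (p *_) (trans (cong (_/ p) eq) (m*n/n≡m c p))) (trans (*-comm p c) (sym eq)))
              (*-monoʳ-∣ p (aux-divides f (suc m / p) (quotient-≤ n≤f) (quotient-pos m p∣n)))

    vp-lower : ∀ {n} r → 0 < n → p ^ r ∣ n → r ≤ vp p n
    vp-lower {n} r = aux-lower n n r ≤-refl

    vp-upper : ∀ {n} r → 0 < n → ¬ (p ^ suc r ∣ n) → vp p n ≤ r
    vp-upper {n} r 0<n nd = ≮⇒≥ (λ r<vp → nd (∣-trans (m≤n⇒m^n∣m^n r<vp) (aux-divides n n ≤-refl 0<n)))
      where
      m≤n⇒m^n∣m^n : ∀ {i j} → i ≤ j → p ^ i ∣ p ^ j
      m≤n⇒m^n∣m^n {i} {j} i≤j = subst (λ l → p ^ i ∣ p ^ l) (m+[n∸m]≡n i≤j)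
          (subst (p ^ i ∣_) (sym (^-distribˡ-+-* p i (j ∸ i))) (m∣m*n (p ^ (j ∸ i))))

    vp-exact : ∀ {n} r → 0 < n → p ^ r ∣ n → ¬ (p ^ suc r ∣ n) → vp p n ≡ r
    vp-exact r 0<n d nd = ≤-antisym (vp-upper r 0<n nd) (vp-lower r 0<n d)

    vp-∤ : ∀ {n} → ¬ (p ∣ n) → vp p n ≡ 0
    vp-∤ {zero}  p∤n = ⊥-elim (p∤n (p ∣0))
    vp-∤ {suc m} p∤n = vp-exact 0 z<s (1∣ suc m) (λ d → p∤n (subst (_∣ suc m) (*-identityʳ p) d))

-- The ideals p^e ℤ₍ₚ₎ in ℚ and their relation to `vpℚ`.

module PIntegral where
  open import Defs using (vp; vpℚ)
  open import Data.Nat as ℕ using (ℕ; suc)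
  import Data.Nat.Properties as ℕ
  import Data.Nat.Divisibility as ℕ
  open import Data.Nat.Coprimality using (Coprime; recompute)
  open import Data.Nat.Primality using (Prime)
  open import Data.Integer as ℤ using (ℤ; +_; ∣_∣)
  import Data.Integer.Properties as ℤ
  open import Data.Integer.Divisibility.Signed
  import Data.Integer.Tactic.RingSolver as ℤ-Solver
  open import Data.Rational hiding (∣_∣)
  open import Data.Rational.Properties
  open import Data.Product using (_,_)
  open import Tactic.RingSolver using (solve-∀)
  open import Relation.Nullary using (¬_)
  open import Relation.Binary.PropositionalEquality
  open RationalRing
  open Embedding
  open BinomialTransform using (Additive)
  open IntegerDivisibility
  open Valuation

  module _ (q : ℕ) (pp : Prime (suc q)) (0<q : 0 ℕ.< q) where
    private
      p : ℕ
      p = suc q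
      P : ℤ
      P = + p

    -- D e x says that x ∈ p^e ℤ₍ₚ₎.
    record D (e : ℕ) (x : ℚ) : Set where
      constructor frac
      field
        u d      : ℤ
        p∤d      : ¬ (P ∣ d)
        equality : x * ι d ≡ ι (P ℤ.^ e ℤ.* u)

    private
      p∤1 : ¬ (P ∣ + 1)
      p∤1 = pos-∤ (ℕ.s≤s ℕ.z≤n) (ℕ.s≤s 0<q)

    D-ι : ∀ e {z} → P ℤ.^ e ∣ z → D e (ι z)
    D-ι e {z} (divides u eq) = frac u (+ 1) p∤1
        (trans (cong (ι z *_) ι-1) (trans (*-identityʳ (ι z)) (cong ι (trans eq (ℤ.*-comm u (P ℤ.^ e))))))

    D-ι⁻¹ : ∀ e {z} → D e (ι z) → P ℤ.^ e ∣ z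
    D-ι⁻¹ e {z} (frac u d p∤d eq) = cancel-unit pp e p∤d
        (divides u (trans (ℤ.*-comm d z) (trans (ι-injective (trans (ι-* z d) eq)) (ℤ.*-comm (P ℤ.^ e) u))))

    D-additive : ∀ e → Additive (D e)
    D-additive e = record
      { 0-closed = subst (D e) ι-0 (D-ι e ∣0)
      ; +-closed = sum
      }
      where
      sum : ∀ {x y} → D e x → D e y → D e (x + y)
      sum {x} {y} (frac u d p∤d eq) (frac u′ d′ p∤d′ eq′) = frac (u ℤ.* d′ ℤ.+ u′ ℤ.* d) (d ℤ.* d′)
          (prime-∤-* pp p∤d p∤d′) (begin
        (x + y) * ι (d ℤ.* d′)                       ≡⟨ cong ((x + y) *_) (ι-* d d′) ⟩
        (x + y) * (ι d * ι d′)                       ≡⟨ expand x y (ι d) (ι d′) ⟩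
        x * ι d * ι d′ + y * ι d′ * ι d              ≡⟨ cong₂ (λ a b → a * ι d′ + b * ι d) eq eq′ ⟩
        ι (M ℤ.* u) * ι d′ + ι (M ℤ.* u′) * ι d      ≡⟨ cong₂ _+_ (ι-* (M ℤ.* u) d′) (ι-* (M ℤ.* u′) d) ⟨
        ι (M ℤ.* u ℤ.* d′) + ι (M ℤ.* u′ ℤ.* d)      ≡⟨ ι-+ (M ℤ.* u ℤ.* d′) (M ℤ.* u′ ℤ.* d) ⟨
        ι (M ℤ.* u ℤ.* d′ ℤ.+ M ℤ.* u′ ℤ.* d)        ≡⟨ cong ι (factor M u d u′ d′) ⟩
        ι (M ℤ.* (u ℤ.* d′ ℤ.+ u′ ℤ.* d))            ∎)
        where
        open ≡-Reasoning
        M : ℤ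
        M = P ℤ.^ e
        expand : ∀ x y a b → (x + y) * (a * b) ≡ x * a * b + y * b * a
        expand = solve-∀ ℚ-ring
        factor : ∀ M u d u′ d′ → M ℤ.* u ℤ.* d′ ℤ.+ M ℤ.* u′ ℤ.* d ≡ M ℤ.* (u ℤ.* d′ ℤ.+ u′ ℤ.* d)
        factor = ℤ-Solver.solve-∀

    D-neg : ∀ e {x} → D e x → D e (- x)
    D-neg e {x} (frac u d p∤d eq) = frac (ℤ.- u) d p∤d
      (trans (sym (neg-distribˡ-* x (ι d)))
          (trans (cong -_ eq) (trans (sym (ι-neg _)) (cong ι (ℤ.neg-distribʳ-* (P ℤ.^ e) u)))))

    D-cancel : ∀ e {z x} → ¬ (P ∣ z) → D e (ι z * x) → D e x
    D-cancel e {z} {x} p∤z (frac u d p∤d eq) = frac u (z ℤ.* d) (prime-∤-* pp p∤z p∤d)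
      (trans (cong (x *_) (ι-* z d)) (trans (identity x (ι z) (ι d)) eq))
      where
      identity : ∀ x z d → x * (z * d) ≡ z * x * d
      identity = solve-∀ ℚ-ring

    D-*P : ∀ e {x} → D e x → D (suc e) (ι P * x)
    D-*P e {x} (frac u d p∤d eq) = frac u d p∤d
      (trans (*-assoc (ι P) x (ι d))
          (trans (cong (ι P *_) eq) (trans (sym (ι-* P _)) (cong ι (sym (ℤ.*-assoc P (P ℤ.^ e) u))))))

    D-/P : ∀ e {x} → D (suc e) (ι P * x) → D e x
    D-/P e {x} (frac u d p∤d eq) = frac u d p∤d (cancel (trans (sym (*-assoc (ι P) x (ι d)))
        (trans eq (trans (cong ι (ℤ.*-assoc P (P ℤ.^ e) u)) (ι-* P (P ℤ.^ e ℤ.* u))))))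
      where
      left-inverse : ∀ y → + 1 / p * (ι P * y) ≡ y
      left-inverse y = trans (identity (+ 1 / p) (ι P) y) (ι-inverse q y)
        where
        identity : ∀ a b c → a * (b * c) ≡ b * (a * c)
        identity = solve-∀ ℚ-ring
      cancel : ∀ {y z} → ι P * y ≡ ι P * z → y ≡ z
      cancel {y} {z} eq = trans (sym (left-inverse y)) (trans (cong (+ 1 / p *_) eq) (left-inverse z))

    D-weaken : ∀ e {x} → D (suc e) x → D e x
    D-weaken e (frac u d p∤d eq) = frac (P ℤ.* u) d p∤d (trans eq (cong ι (identity P (P ℤ.^ e) u)))
      where
      identity : ∀ a b c → a ℤ.* b ℤ.* c ≡ b ℤ.* (a ℤ.* c)
      identity = ℤ-Solver.solve-∀

    private
      cross : ∀ e x u d → x * ι d ≡ ι (P ℤ.^ e ℤ.* u) → ↥ x ℤ.* d ≡ P ℤ.^ e ℤ.* u ℤ.* ↧ x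
      cross e x u d eq = ι-injective (begin
        ι (↥ x ℤ.* d)                   ≡⟨ ι-* (↥ x) d ⟩
        ι (↥ x) * ι d                   ≡⟨ cong (_* ι d) (ι-numerator x) ⟨
        x * ι (↧ x) * ι d               ≡⟨ identity x (ι (↧ x)) (ι d) ⟩
        x * ι d * ι (↧ x)               ≡⟨ cong (_* ι (↧ x)) eq ⟩
        ι (P ℤ.^ e ℤ.* u) * ι (↧ x)     ≡⟨ ι-* (P ℤ.^ e ℤ.* u) (↧ x) ⟨
        ι (P ℤ.^ e ℤ.* u ℤ.* ↧ x)       ∎)
        where
        open ≡-Reasoning
        identity : ∀ a b c → a * b * c ≡ a * c * b
        identity = solve-∀ ℚ-ring

      cancel₁ : ∀ {c x} → ¬ (P ∣ c) → P ∣ c ℤ.* x → P ∣ x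
      cancel₁ {c} {x} p∤c d = subst (_∣ x) (ℤ.*-identityʳ P)
          (cancel-unit pp 1 p∤c (subst (_∣ c ℤ.* x) (sym (ℤ.*-identityʳ P)) d))

      coprime : ∀ x → Coprime ∣ ↥ x ∣ (↧ₙ x)
      coprime (mkℚ n d-1 c) = recompute c

    -- Cross-multiplying with the given fraction, a p in the reduced denominator would also divide
    -- the reduced numerator, against coprimality.
    p∤denominator : ∀ {x} → D 0 x → ¬ (p ℕ.∣ ↧ₙ x)
    p∤denominator {x} (frac u d p∤d eq) p∣↧ = ℕ.<⇒≢ (ℕ.s≤s 0<q) (sym (coprime x (∣⇒∣ᵤ p∣↥ , p∣↧)))
      where
      p∣↥ : P ∣ ↥ x
      p∣↥ = cancel₁ p∤d (subst (P ∣_) (trans (sym (cross 0 x u d eq)) (ℤ.*-comm (↥ x) d))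
          (∣n⇒∣m*n (+ 1 ℤ.* u) (∣ᵤ⇒∣ {P} {↧ x} p∣↧)))

    D₁⇒p∣numerator : ∀ {x} → D 1 x → P ∣ ↥ x
    D₁⇒p∣numerator {x} (frac u d p∤d eq) = cancel₁ p∤d
        (subst (P ∣_) (trans (sym (cross 1 x u d eq)) (ℤ.*-comm (↥ x) d))
      (∣m⇒∣m*n (↧ x) (∣m⇒∣m*n u (∣m⇒∣m*n (+ 1) ∣-refl))))

    p∣numerator⇒D₁ : ∀ {x} → D 0 x → P ∣ ↥ x → D 1 x
    p∣numerator⇒D₁ {x} d₀ (divides u eq) = frac u (↧ x) (λ p∣↧ → p∤denominator d₀ (∣⇒∣ᵤ p∣↧))
      (trans (ι-numerator x) (cong ι (trans eq (trans (ℤ.*-comm u P) (cong (ℤ._* u) (sym (ℤ.*-identityʳ P)))))))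

    -- The hypothesis x ≢ 0 excludes the junk value vpℚ p 0 = 0.
    vpℚ≡0⇒¬D₁ : ∀ {x} → x ≢ 0ℚ → D 0 x → vpℚ p x ≡ + 0 → ¬ D 1 x
    vpℚ≡0⇒¬D₁ {x} x≢0 d₀ v≡0 d₁ = ℕ.<⇒≢
        (vp-lower q 0<q 1 numerator-pos (subst (ℕ._∣ ∣ ↥ x ∣) (sym (ℕ.*-identityʳ p))
        (∣⇒∣ᵤ (D₁⇒p∣numerator d₁)))) (sym vp≡0)
      where
      numerator-pos : 0 ℕ.< ∣ ↥ x ∣
      numerator-pos = ℕ.n≢0⇒n>0 (λ eq → x≢0 (↥p≡0⇒p≡0 x (ℤ.∣i∣≡0⇒i≡0 eq)))
      vp≡0 : vp p ∣ ↥ x ∣ ≡ 0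
      vp≡0 = ℤ.+-injective (trans (sym (ℤ.+-identityʳ (+ vp p ∣ ↥ x ∣)))
          (trans (cong (λ v → + vp p ∣ ↥ x ∣ ℤ.- + v) (sym (vp-∤ q 0<q (p∤denominator d₀)))) v≡0))

    ¬D₁⇒vpℚ≡0 : ∀ {x} → D 0 x → ¬ D 1 x → vpℚ p x ≡ + 0
    ¬D₁⇒vpℚ≡0 {x} d₀ ¬d₁ = cong₂ (λ a b → + a ℤ.- + b)
      (vp-∤ q 0<q (λ d → ¬d₁ (p∣numerator⇒D₁ d₀ (∣ᵤ⇒∣ d)))) (vp-∤ q 0<q (p∤denominator d₀))

-- Bernoulli numbers and power sums modulo p².

module Bernoulli where
  open import Defs using (bernRev; bernoulli)
  open import Data.Nat as ℕ using (ℕ; zero; suc)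
  import Data.Nat.Properties as ℕ
  open import Data.Nat.Combinatorics using (_C_; nCn≡1; nC1≡n; nCk≡nC[n∸k])
  open import Data.Nat.Induction using (<-rec)
  open import Data.Nat.Primality using (Prime)
  open import Data.List using (_∷ʳ_; foldr; zipWith; reverse; upTo; applyUpTo)
  open import Data.List.Properties using (unfold-reverse; applyUpTo-∷ʳ)
  open import Data.Integer as ℤ using (ℤ; +_)
  import Data.Integer.Properties as ℤ
  open import Data.Integer.Divisibility.Signed
  open import Data.Rational
  open import Data.Rational.Properties
  open import Function using (_∘_)
  open import Tactic.RingSolver using (solve-∀)
  open import Relation.Binary.PropositionalEquality
  open SymmetricFunctions using (power-sum)
  open RationalRing
  open Embedding
  open BinomialTransform
  open IntegerDivisibility using (pos-∤; ^-monoʳ-∣)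
  open PIntegral

  δ₁ : ℕ → ℚ
  δ₁ 1 = 1ℚ
  δ₁ _ = 0ℚ

  private
    reverse-bernRev : ∀ n → reverse (bernRev n) ≡ applyUpTo bernoulli (suc n)
    reverse-bernRev zero    = refl
    reverse-bernRev (suc n) = trans (unfold-reverse (bernoulli (suc n)) (bernRev n))
      (trans (cong (_∷ʳ bernoulli (suc n)) (reverse-bernRev n)) (applyUpTo-∷ʳ bernoulli (suc n)))

    foldr-zipWith : ∀ (g : ℕ → ℚ → ℚ) a b n → foldr _+_ 0ℚ (zipWith g (applyUpTo a n) (applyUpTo b n)) ≡ Σ< n
        (λ j → g (a j) (b j))
    foldr-zipWith g a b zero    = refl
    foldr-zipWith g a b (suc n) = cong (_+_ (g (a 0) (b 0))) (foldr-zipWith g (a ∘ suc) (b ∘ suc) n)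

    defining-sum : ∀ n → foldr _+_ 0ℚ (zipWith (λ j b → (+ (suc (suc n) C j) / 1) * b) (upTo (suc n))
        (reverse (bernRev n)))
      ≡ binomial-sum (suc (suc n)) bernoulli (suc n)
    defining-sum n = trans (cong (λ bs → foldr _+_ 0ℚ (zipWith (λ j b → (+ (suc (suc n) C j) / 1) * b)
        (upTo (suc n)) bs)) (reverse-bernRev n))
      (trans (foldr-zipWith (λ j b → (+ (suc (suc n) C j) / 1) * b) (λ j → j) bernoulli (suc n))
        (Σ<-cong (suc n) (λ j → cong (_* bernoulli j) (ι-/1 (+ (suc (suc n) C j))))))

  bernoulli-recurrence : ∀ n → binomial-sum (suc (suc n)) bernoulli (suc n) + ι (+ suc (suc n)) * bernoulli
      (suc n) ≡ 0ℚ
  bernoulli-recurrence n = trans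
      (cong (λ s → binomial-sum (suc (suc n)) bernoulli (suc n) + ι (+ suc (suc n)) * -
      (+ 1 / suc (suc n) * s)) (defining-sum n))
    (cancel (binomial-sum (suc (suc n)) bernoulli (suc n)))
    where
    cancel : ∀ s → s + ι (+ suc (suc n)) * - (+ 1 / suc (suc n) * s) ≡ 0ℚ
    cancel s = trans (cong (_+_ s) (trans (sym (neg-distribʳ-* (ι (+ suc (suc n))) (+ 1 / suc (suc n) * s)))
        (cong -_ (ι-inverse (suc n) s)))) (+-inverseʳ s)

  -- Umbrally (1 + B)^n = B^n. For n ≥ 2 the terms below the top one form the defining recurrence.
  -- The exception `δ₁` reflects B_1 = -1/2, as 1 + B_1 = B_1 + 1.
  T-bernoulli : ∀ n → T bernoulli n ≡ bernoulli n + δ₁ n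
  T-bernoulli 0             = refl
  T-bernoulli 1             = refl
  T-bernoulli (suc (suc n)) = begin
    T bernoulli N                                                   ≡⟨ T-binomial bernoulli N ⟩
    binomial-sum N bernoulli (suc N)                                ≡⟨ Σ<-last N (λ j → ι (+ (N C j)) * bernoulli j) ⟩
    binomial-sum N bernoulli N + ι (+ (N C N)) * bernoulli N        ≡⟨ cong₂ _+_ vanish last ⟩
    0ℚ + bernoulli N                                                ≡⟨ +-comm 0ℚ (bernoulli N) ⟩
    bernoulli N + 0ℚ                                                ∎
    where
    open ≡-Reasoning
    N : ℕ
    N = suc (suc n)
    last : ι (+ (N C N)) * bernoulli N ≡ bernoulli N
    last = trans (cong (λ c → ι (+ c) * bernoulli N) (nCn≡1 N)) (trans (cong (_* bernoulli N) ι-1)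
        (*-identityˡ (bernoulli N)))
    coefficient : N C suc n ≡ N
    coefficient = trans (nCk≡nC[n∸k] (ℕ.n≤1+n (suc n))) (trans (cong (N C_) (ℕ.m+n∸n≡m 1 (suc n))) (nC1≡n N))
    vanish : binomial-sum N bernoulli N ≡ 0ℚ
    vanish = trans (Σ<-last (suc n) (λ j → ι (+ (N C j)) * bernoulli j))
      (trans (cong (λ c → binomial-sum N bernoulli (suc n) + ι (+ c) * bernoulli (suc n)) coefficient)
          (bernoulli-recurrence n))

  -- Strong induction: when all X_j with j < m lie in Φ, `T-top₂` reduces the fixed-point equation
  -- at m + 1 to Φ ((m + 1) X_m), and `divide` removes the factor. Applied to the difference of two
  -- solutions it gives uniqueness.
  T-unique : ∀ {Φ : ℚ → Set} → Additive Φ → ∀ M X →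
    (∀ m → m ℕ.< M → ∀ x → Φ (ι (+ suc m) * x) → Φ x) →
    (∀ m → m ℕ.< M → Φ (T X (suc m) - X (suc m))) → (∀ {x} → Φ x → Φ (- x)) →
    ∀ j → j ℕ.< M → Φ (X j)
  T-unique {Φ} additive M X divide fixed neg = <-rec (λ j → j ℕ.< M → Φ (X j)) (λ m below m<M →
    divide m m<M (X m) (subst Φ (identity (T X (suc m) - X (suc m)) (ι (+ suc m) * X m))
      (Additive.+-closed additive (fixed m m<M)
          (neg (T-top₂ additive X m (λ j j<m → below j<m (ℕ.<-trans j<m m<M)))))))
    where
    identity : ∀ a b → a + - (a - b) ≡ b
    identity = solve-∀ ℚ-ring

  ≡0-additive : Additive (_≡ 0ℚ)
  ≡0-additive = record { 0-closed = refl ; +-closed = λ x≡0 y≡0 → cong₂ _+_ x≡0 y≡0 }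

  ι-suc-cancel : ∀ m x → ι (+ suc m) * x ≡ 0ℚ → x ≡ 0ℚ
  ι-suc-cancel m x eq = trans (sym (ι-inverse m x)) (trans (identity (ι (+ suc m)) (+ 1 / suc m) x)
      (trans (cong (_*_ (+ 1 / suc m)) eq) (*-zeroʳ (+ 1 / suc m))))
    where
    identity : ∀ a b c → a * (b * c) ≡ b * (a * c)
    identity = solve-∀ ℚ-ring

  -- By binomial inversion (-1)ⁿ (B_n + δ₁ n) satisfies the recurrence that determines B.
  bernoulli-reflection : ∀ n → alt (T bernoulli) n ≡ bernoulli n
  bernoulli-reflection n = trans (identity (Y n) (bernoulli n)) (trans (cong (_+ bernoulli n)
      (T-unique ≡0-additive (suc n) Z (λ m _ → ι-suc-cancel m)
          (λ m _ → trans (cong (_- Z (suc m)) (fixed (suc m))) (+-inverseʳ (Z (suc m)))) (λ eq → cong -_ eq) n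
          (ℕ.n<1+n n))) (+-identityˡ (bernoulli n)))
    where
    Y Z : ℕ → ℚ
    Y = alt (T bernoulli)
    Z j = Y j + - 1ℚ * bernoulli j
    identity : ∀ a b → a ≡ a + - 1ℚ * b + b
    identity = solve-∀ ℚ-ring
    alt-δ₁ : ∀ j → alt δ₁ j ≡ - δ₁ j
    alt-δ₁ 0             = refl
    alt-δ₁ 1             = refl
    alt-δ₁ (suc (suc j)) = zero-alt j
      where
      zero-alt : ∀ j → - - alt (λ _ → 0ℚ) j ≡ 0ℚ
      zero-alt zero    = refl
      zero-alt (suc j) = cong -_ (zero-alt j)
    fixed : ∀ m → T Z m ≡ Z m
    fixed m = begin
      T Z m                                                     ≡⟨ T-linear (- 1ℚ) Y bernoulli m ⟩
      T Y m + - 1ℚ * T bernoulli m                              ≡⟨ cong₂ (λ a b → a + - 1ℚ * b)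
          (T-alt-T bernoulli m) (T-bernoulli m) ⟩
      alt bernoulli m + - 1ℚ * (bernoulli m + δ₁ m)             ≡⟨ rearrange (alt bernoulli m) (bernoulli m) (δ₁ m) ⟩
      alt bernoulli m + - δ₁ m + - 1ℚ * bernoulli m             ≡⟨ cong
          (λ a → alt bernoulli m + a + - 1ℚ * bernoulli m) (alt-δ₁ m) ⟨
      alt bernoulli m + alt δ₁ m + - 1ℚ * bernoulli m           ≡⟨ cong (_+ - 1ℚ * bernoulli m)
          (alt-+ bernoulli δ₁ m) ⟨
      alt (λ j → bernoulli j + δ₁ j) m + - 1ℚ * bernoulli m     ≡⟨ cong (_+ - 1ℚ * bernoulli m)
          (alt-cong T-bernoulli m) ⟨
      Z m                                                       ∎
      where
      open ≡-Reasoning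
      rearrange : ∀ a b c → a + - 1ℚ * (b + c) ≡ a + - c + - 1ℚ * b
      rearrange = solve-∀ ℚ-ring

  -- For odd n ≥ 3 the correction `δ₁` is absent and the sign in `alt` is negative, so the
  -- reflection reads - B = B.
  bernoulli-odd : ∀ h → bernoulli (3 ℕ.+ h ℕ.* 2) ≡ 0ℚ
  bernoulli-odd h = ι-suc-cancel 1 B (trans (cong (_* B) (trans (ι-suc 1) (cong (_+_ 1ℚ) ι-1)))
      (trans (double B) (trans (cong (_+_ B) (sym negated)) (+-inverseʳ B))))
    where
    n : ℕ
    n = 3 ℕ.+ h ℕ.* 2
    B : ℚ
    B = bernoulli n
    double : ∀ b → (1ℚ + 1ℚ) * b ≡ b + b
    double = solve-∀ ℚ-ring
    alt-odd : ∀ h X → alt X (1 ℕ.+ h ℕ.* 2) ≡ - X (1 ℕ.+ h ℕ.* 2)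
    alt-odd zero    X = refl
    alt-odd (suc h) X = trans (neg-involutive (alt (X ∘ suc ∘ suc) (1 ℕ.+ h ℕ.* 2))) (alt-odd h (X ∘ suc ∘ suc))
      where
      neg-involutive : ∀ a → - - a ≡ a
      neg-involutive = solve-∀ ℚ-ring
    negated : - B ≡ B
    negated = trans (cong -_ (sym (trans (T-bernoulli n) (+-identityʳ B))))
        (trans (sym (alt-odd (suc h) (T bernoulli))) (bernoulli-reflection n))

  power : ℤ → ℕ → ℚ
  power z j = ι (z ℤ.^ j)

  T-power : ∀ x n → T (power (+ x)) n ≡ power (+ suc x) n
  T-power x zero    = refl
  T-power x (suc n) = begin
    T (λ j → power (+ x) j + ι (+ x ℤ.* (+ x) ℤ.^ j)) n   ≡⟨ T-cong (λ j → cong (_+_ (power (+ x) j))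
        (ι-* (+ x) ((+ x) ℤ.^ j))) n ⟩
    T (λ j → power (+ x) j + ι (+ x) * power (+ x) j) n   ≡⟨ T-linear (ι (+ x)) (power (+ x)) (power (+ x)) n ⟩
    T (power (+ x)) n + ι (+ x) * T (power (+ x)) n       ≡⟨ factor (ι (+ x)) (T (power (+ x)) n) ⟩
    (1ℚ + ι (+ x)) * T (power (+ x)) n                    ≡⟨ cong₂ _*_ (sym (ι-suc x)) (T-power x n) ⟩
    ι (+ suc x) * power (+ suc x) n                       ≡⟨ ι-* (+ suc x) ((+ suc x) ℤ.^ n) ⟨
    power (+ suc x) (suc n)                               ∎
    where
    open ≡-Reasoning
    factor : ∀ x a → a + x * a ≡ (1ℚ + x) * a
    factor = solve-∀ ℚ-ring

  -- The transform replaces each i^m by (i + 1)^m, so both sides are the sum of i^m over 0 ≤ i ≤ n.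
  -- The term i = 0 is kept because 0^0 = 1.
  T-power-sum : ∀ n m → T (λ j → ι (power-sum +_ n j)) m + power (+ 0) m ≡ ι (power-sum +_ n m) + power (+ n) m
  T-power-sum zero    m = cong (_+ power (+ 0) m) (trans (T-cong (λ _ → ι-0) m) (trans (T-zero m) (sym ι-0)))
    where
    T-zero : ∀ m → T (λ _ → 0ℚ) m ≡ 0ℚ
    T-zero zero    = refl
    T-zero (suc m) = T-zero m
  T-power-sum (suc n) m = begin
    T (λ j → ι (power-sum +_ n j ℤ.+ (+ n) ℤ.^ j)) m + power (+ 0) m
      ≡⟨ cong (_+ power (+ 0) m) (trans (T-cong (λ j → ι-+ (power-sum +_ n j) ((+ n) ℤ.^ j)) m)
          (T-+ S (power (+ n)) m)) ⟩
    T S m + T (power (+ n)) m + power (+ 0) m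
      ≡⟨ swap (T S m) (T (power (+ n)) m) (power (+ 0) m) ⟩
    T S m + power (+ 0) m + T (power (+ n)) m
      ≡⟨ cong₂ _+_ (T-power-sum n m) (T-power n m) ⟩
    ι (power-sum +_ n m) + power (+ n) m + power (+ suc n) m
      ≡⟨ cong (_+ power (+ suc n) m) (ι-+ (power-sum +_ n m) ((+ n) ℤ.^ m)) ⟨
    ι (power-sum +_ (suc n) m) + power (+ suc n) m ∎
    where
    open ≡-Reasoning
    S : ℕ → ℚ
    S j = ι (power-sum +_ n j)
    swap : ∀ a b c → a + b + c ≡ a + c + b
    swap = solve-∀ ℚ-ring

  T-power-sum-suc : ∀ n m → T (λ j → ι (power-sum +_ n j)) (suc m) ≡ ι (power-sum +_ n (suc m)) + power (+ n) (suc m)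
  T-power-sum-suc n m = trans (sym (trans (cong (_+_ (T (λ j → ι (power-sum +_ n j)) (suc m))) ι-0)
      (+-identityʳ _))) (T-power-sum n (suc m))

  module _ (q : ℕ) (pp : Prime (suc q)) (0<q : 0 ℕ.< q) where
    private
      p : ℕ
      p = suc q
      P : ℤ
      P = + p
      S : ℕ → ℚ
      S j = ι (power-sum +_ p j)

      divide : ∀ e m → m ℕ.< q → ∀ x → D q pp 0<q e (ι (+ suc m) * x) → D q pp 0<q e x
      divide e m m<q x = D-cancel q pp 0<q e (pos-∤ ℕ.z<s (ℕ.s≤s m<q))

    -- The power sums are fixed by the transform up to p^(m+1), which vanishes modulo p, and every m
    -- + 1 ≤ q is a unit.
    power-sum-p : ∀ j → j ℕ.< q → P ∣ power-sum +_ p j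
    power-sum-p j j<q = subst (_∣ power-sum +_ p j) (ℤ.*-identityʳ P) (D-ι⁻¹ q pp 0<q 1
      (T-unique (D-additive q pp 0<q 1) q S (divide 1)
        (λ m _ → subst (D q pp 0<q 1) (fixed m) (D-ι q pp 0<q 1 (^-monoʳ-∣ P {1} {suc m} (ℕ.s≤s ℕ.z≤n))))
            (D-neg q pp 0<q 1) j j<q))
      where
      identity : ∀ a b → b ≡ a + b - a
      identity = solve-∀ ℚ-ring
      fixed : ∀ m → power P (suc m) ≡ T S (suc m) - S (suc m)
      fixed m = trans (identity (S (suc m)) (power P (suc m))) (cong (_- S (suc m)) (sym (T-power-sum-suc p m)))

    -- Both S_j and p B_j are fixed by the transform up to an explicit defect, p^(m+1) and p `δ₁` (m
    -- + 1), and these agree modulo p².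
    power-sum-bernoulli : ∀ j → j ℕ.< q → D q pp 0<q 2 (S j + - ι P * bernoulli j)
    power-sum-bernoulli = T-unique (D-additive q pp 0<q 2) q X (divide 2)
      (λ m _ → subst (D q pp 0<q 2) (fixed m) (error m)) (D-neg q pp 0<q 2)
      where
      X : ℕ → ℚ
      X j = S j + - ι P * bernoulli j
      identity : ∀ s w c b d → w + c * d ≡ s + w + c * (b + d) - (s + c * b)
      identity = solve-∀ ℚ-ring
      fixed : ∀ m → power P (suc m) + - ι P * δ₁ (suc m) ≡ T X (suc m) - X (suc m)
      fixed m = trans (identity (S (suc m)) (power P (suc m)) (- ι P) (bernoulli (suc m)) (δ₁ (suc m)))
        (cong (_- X (suc m)) (sym (trans (T-linear (- ι P) S bernoulli (suc m))
            (cong₂ (λ a b → a + - ι P * b) (T-power-sum-suc p m) (T-bernoulli (suc m))))))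
      error : ∀ m → D q pp 0<q 2 (power P (suc m) + - ι P * δ₁ (suc m))
      -- At m = 0 the defect p^1 is no multiple of p², but it cancels exactly against p `δ₁` 1 = p.
      error zero    = subst (D q pp 0<q 2)
          (sym (trans (cong₂ _+_ (cong ι (ℤ.*-identityʳ P)) (*-identityʳ (- ι P))) (+-inverseʳ (ι P))))
                        (Additive.0-closed (D-additive q pp 0<q 2))
      error (suc m) = subst (D q pp 0<q 2) (sym (trans (cong (_+_ (power P (suc (suc m)))) (*-zeroʳ (- ι P)))
          (+-identityʳ _)))
                        (D-ι q pp 0<q 2 (^-monoʳ-∣ P {2} {suc (suc m)} (ℕ.s≤s (ℕ.s≤s ℕ.z≤n))))

    D-P-bernoulli : ∀ e j → e ℕ.≤ 2 → j ℕ.< q → P ℤ.^ e ∣ power-sum +_ p j → D q pp 0<q e (ι P * bernoulli j)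
    D-P-bernoulli e j e≤2 j<q d = subst (D q pp 0<q e) (identity (S j) (ι P) (bernoulli j))
      (Additive.+-closed (D-additive q pp 0<q e) (D-ι q pp 0<q e d)
          (D-neg q pp 0<q e (lower e e≤2 (power-sum-bernoulli j j<q))))
      where
      identity : ∀ s c b → s + - (s + - c * b) ≡ c * b
      identity = solve-∀ ℚ-ring
      lower : ∀ e → e ℕ.≤ 2 → ∀ {x} → D q pp 0<q 2 x → D q pp 0<q e x
      lower 0 _ = D-weaken q pp 0<q 0 ∘ D-weaken q pp 0<q 1
      lower 1 _ = D-weaken q pp 0<q 1
      lower 2 _ d = d
      lower (suc (suc (suc e))) (ℕ.s≤s (ℕ.s≤s ()))

    bernoulli-integral : ∀ j → j ℕ.< q → D q pp 0<q 0 (bernoulli j)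
    bernoulli-integral j j<q = D-/P q pp 0<q 0 (D-P-bernoulli 1 j (ℕ.s≤s ℕ.z≤n) j<q
      (subst (_∣ power-sum +_ p j) (sym (ℤ.*-identityʳ P)) (power-sum-p j j<q)))

    p²∣power-sum⇒D₁ : ∀ j → j ℕ.< q → P ℤ.^ 2 ∣ power-sum +_ p j → D q pp 0<q 1 (bernoulli j)
    p²∣power-sum⇒D₁ j j<q d = D-/P q pp 0<q 1 (D-P-bernoulli 2 j (ℕ.s≤s (ℕ.s≤s ℕ.z≤n)) j<q d)

    D₁⇒p²∣power-sum : ∀ j → j ℕ.< q → D q pp 0<q 1 (bernoulli j) → P ℤ.^ 2 ∣ power-sum +_ p j
    D₁⇒p²∣power-sum j j<q d = D-ι⁻¹ q pp 0<q 2 (subst (D q pp 0<q 2) (identity (S j) (ι P) (bernoulli j))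
      (Additive.+-closed (D-additive q pp 0<q 2) (power-sum-bernoulli j j<q) (D-*P q pp 0<q 1 d)))
      where
      identity : ∀ s c b → s + - c * b + c * b ≡ s
      identity = solve-∀ ℚ-ring

-- Bernoulli numbers of even index do not vanish, by a 2-adic argument.

module BernoulliNonzero where
  open import Defs using (bernoulli)
  open import Data.Nat as ℕ using (ℕ; zero; suc)
  import Data.Nat.Properties as ℕ
  import Data.Nat.Divisibility as ℕ
  open import Data.Nat.Induction using (<-rec)
  open import Data.Nat.Primality using (prime[2])
  open import Data.Integer as ℤ using (ℤ; +_)
  import Data.Integer.Properties as ℤ
  open import Data.Integer.Divisibility.Signed
  open import Data.Rational
  open import Data.Rational.Properties
  open import Data.Product using (∃; _,_)
  open import Data.Sum using (_⊎_; inj₁; inj₂)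
  open import Tactic.RingSolver using (solve-∀)
  open import Relation.Nullary using (¬_)
  open import Relation.Binary.PropositionalEquality
  open RationalRing
  open Embedding
  open BinomialTransform
  open IntegerDivisibility using (pos-∤)
  open PIntegral
  open Bernoulli

  even-or-odd : ∀ n → (∃ λ h → n ≡ h ℕ.* 2) ⊎ (∃ λ h → n ≡ suc (h ℕ.* 2))
  even-or-odd zero    = inj₁ (0 , refl)
  even-or-odd (suc n) with even-or-odd n
  ... | inj₁ (h , refl) = inj₂ (h , refl)
  ... | inj₂ (h , refl) = inj₁ (suc h , refl)

  private
    -- - d j is the residue of 2 B_j modulo 2: it is 1 for j = 1 and for even j ≥ 2, otherwise 0.
    ev δ₀ d Y : ℕ → ℚ
    ev 0             = 1ℚ
    ev 1             = 0ℚ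
    ev (suc (suc j)) = ev j
    δ₀ zero    = 1ℚ
    δ₀ (suc j) = 0ℚ
    d j = δ₀ j + - 1ℚ * (ev j + δ₁ j)
    Y j = d j + ι (+ 2) * bernoulli j

    ev-even : ∀ h → ev (h ℕ.* 2) ≡ 1ℚ
    ev-even zero    = refl
    ev-even (suc h) = ev-even h

    ev-odd : ∀ h → ev (suc (h ℕ.* 2)) ≡ 0ℚ
    ev-odd zero    = refl
    ev-odd (suc h) = ev-odd h

    T-ev : ∀ n → T ev (suc n) ≡ power (+ 2) n
    T-ev n = trans (T-cong (λ j → trans (sum j) (sym (trans (cong ι (ℤ.^-zeroˡ j)) ι-1))) n) (T-power 1 n)
      where
      sum : ∀ j → ev j + ev (suc j) ≡ 1ℚ
      sum 0             = refl
      sum 1             = refl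
      sum (suc (suc j)) = sum j

    T-δ₀ : ∀ n → T δ₀ n ≡ 1ℚ
    T-δ₀ zero    = refl
    T-δ₀ (suc n) = trans (T-cong (λ j → +-identityʳ (δ₀ j)) n) (T-δ₀ n)

    T-δ₁ : ∀ n → T δ₁ n ≡ ι (+ n)
    T-δ₁ zero    = sym ι-0
    T-δ₁ (suc n) = trans (T-cong (λ j → cong (_+_ (δ₁ j)) (δ₁-suc j)) n) (trans (T-+ δ₁ δ₀ n)
      (trans (cong₂ _+_ (T-δ₁ n) (T-δ₀ n)) (trans (+-comm (ι (+ n)) 1ℚ) (sym (ι-suc n)))))
      where
      δ₁-suc : ∀ j → δ₁ (suc j) ≡ δ₀ j
      δ₁-suc zero    = refl
      δ₁-suc (suc j) = refl

    T-d : ∀ n → T d (suc n) ≡ ι (ℤ.- (+ n ℤ.+ (+ 2) ℤ.^ n))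
    T-d n = begin
      T d (suc n)
        ≡⟨ T-linear (- 1ℚ) δ₀ (λ j → ev j + δ₁ j) (suc n) ⟩
      T δ₀ (suc n) + - 1ℚ * T (λ j → ev j + δ₁ j) (suc n)
        ≡⟨ cong₂ (λ a b → a + - 1ℚ * b) (T-δ₀ (suc n))
            (trans (T-+ ev δ₁ (suc n)) (cong₂ _+_ (T-ev n) (trans (T-δ₁ (suc n)) (ι-suc n)))) ⟩
      1ℚ + - 1ℚ * (power (+ 2) n + (1ℚ + ι (+ n)))
        ≡⟨ identity (power (+ 2) n) (ι (+ n)) ⟩
      - (ι (+ n) + power (+ 2) n)
        ≡⟨ trans (ι-neg (+ n ℤ.+ (+ 2) ℤ.^ n)) (cong -_ (ι-+ (+ n) ((+ 2) ℤ.^ n))) ⟨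
      ι (ℤ.- (+ n ℤ.+ (+ 2) ℤ.^ n)) ∎
      where
      open ≡-Reasoning
      identity : ∀ a b → 1ℚ + - 1ℚ * (a + (1ℚ + b)) ≡ - (b + a)
      identity = solve-∀ ℚ-ring

    D₂ : ℕ → ℚ → Set
    D₂ = D 1 prime[2] (ℕ.s≤s ℕ.z≤n)

    D₂-2 : D₂ 1 (ι (+ 2))
    D₂-2 = D-ι 1 prime[2] (ℕ.s≤s ℕ.z≤n) 1 ∣-refl

    -- For even m the multiplier m + 1 is odd and can be cancelled 2-adically. The defect of Y at m
    -- + 1 is -(m + 2^m), which is even because m ≥ 2 is even. For odd m the multiplier is even, so
    -- those indices have to come from `bernoulli-odd`.
    Y-even-step : ∀ h → (∀ j → j ℕ.< suc h ℕ.* 2 → D₂ 1 (Y j)) → D₂ 1 (Y (suc h ℕ.* 2))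
    Y-even-step h below = D-cancel 1 prime[2] (ℕ.s≤s ℕ.z≤n) 1 2∤1+m
        (subst (D₂ 1) (identity (T Y (suc m) - Y (suc m)) (ι (+ suc m) * Y m))
        (Additive.+-closed additive even (D-neg 1 prime[2] (ℕ.s≤s ℕ.z≤n) 1 (T-top₂ additive Y m below))))
      where
      m : ℕ
      m = suc h ℕ.* 2
      additive : Additive (D₂ 1)
      additive = D-additive 1 prime[2] (ℕ.s≤s ℕ.z≤n) 1
      identity : ∀ a b → a + - (a - b) ≡ b
      identity = solve-∀ ℚ-ring
      2∤1+m : ¬ (+ 2 ∣ + suc m)
      2∤1+m 2∣1+m = pos-∤ {2} (ℕ.s≤s ℕ.z≤n) (ℕ.s≤s (ℕ.s≤s ℕ.z≤n))
          (∣ᵤ⇒∣ (ℕ.∣m+n∣m⇒∣n {2} {m} (subst (ℕ._∣_ 2) (ℕ.+-comm 1 m) (∣⇒∣ᵤ 2∣1+m)) (ℕ.n∣m*n (suc h))))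
      2∣m : + 2 ∣ + m
      2∣m = ∣ᵤ⇒∣ (ℕ.n∣m*n (suc h))
      difference : ι (ℤ.- (+ m ℤ.+ (+ 2) ℤ.^ m)) ≡ T Y (suc m) - Y (suc m)
      difference = sym (trans (cong₂ _-_ (trans (T-linear (ι (+ 2)) d bernoulli (suc m))
          (cong₂ (λ a b → a + ι (+ 2) * b) (T-d m) (T-bernoulli (suc m))))
                                      (cong (λ a → 0ℚ + - 1ℚ * (a + 0ℚ) + ι (+ 2) * bernoulli (suc m))
                                          (ev-odd (suc h))))
                         (cancel (ι (ℤ.- (+ m ℤ.+ (+ 2) ℤ.^ m))) (ι (+ 2)) (bernoulli (suc m))))
        where
        cancel : ∀ t c b → t + c * (b + 0ℚ) - (0ℚ + - 1ℚ * (0ℚ + 0ℚ) + c * b) ≡ t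
        cancel = solve-∀ ℚ-ring
      even : D₂ 1 (T Y (suc m) - Y (suc m))
      even = subst (D₂ 1) difference (D-ι 1 prime[2] (ℕ.s≤s ℕ.z≤n) 1
        (∣m⇒∣-m (∣m∣n⇒∣m+n 2∣m (∣m⇒∣m*n ((+ 2) ℤ.^ suc (h ℕ.* 2)) ∣-refl))))

    Y-even : ∀ j → D₂ 1 (Y j)
    Y-even = <-rec (λ j → D₂ 1 (Y j)) step
      where
      step : ∀ j → (∀ {i} → i ℕ.< j → D₂ 1 (Y i)) → D₂ 1 (Y j)
      step j below with even-or-odd j
      ... | inj₁ (0 , refl) = subst (D₂ 1) (identity (ι (+ 2))) D₂-2
        where
        identity : ∀ x → x ≡ 1ℚ + - 1ℚ * (1ℚ + 0ℚ) + x * 1ℚ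
        identity = solve-∀ ℚ-ring
      ... | inj₁ (suc h , refl) = Y-even-step h (λ i i<j → below i<j)
      -- Here d_1 = -1 and 2 B_1 = -1, so Y_1 = -2.
      ... | inj₂ (0 , refl) = subst (D₂ 1)
          (trans (cong -_ two) (cong (λ a → 0ℚ + - 1ℚ * (0ℚ + 1ℚ) + a * bernoulli 1) (sym two)))
          (D-neg 1 prime[2] (ℕ.s≤s ℕ.z≤n) 1 D₂-2)
        where
        two : ι (+ 2) ≡ 1ℚ + 1ℚ
        two = trans (ι-suc 1) (cong (_+_ 1ℚ) ι-1)
      ... | inj₂ (suc h , refl) = subst (D₂ 1) (trans (identity (ι (+ 2)))
              (cong₂ (λ a b → 0ℚ + - 1ℚ * (a + 0ℚ) + ι (+ 2) * b) (sym (ev-odd (suc h))) (sym (bernoulli-odd h))))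
              (Additive.0-closed (D-additive 1 prime[2] (ℕ.s≤s ℕ.z≤n) 1))
        where
        identity : ∀ x → 0ℚ ≡ 0ℚ + - 1ℚ * (0ℚ + 0ℚ) + x * 0ℚ
        identity = solve-∀ ℚ-ring

  -- 2 B_m is an odd 2-adic integer for every even m ≥ 2.
  bernoulli-even≢0 : ∀ h → bernoulli (suc h ℕ.* 2) ≢ 0ℚ
  bernoulli-even≢0 h B≡0 = pos-∤ {2} (ℕ.s≤s ℕ.z≤n) (ℕ.s≤s (ℕ.s≤s ℕ.z≤n)) (D-ι⁻¹ 1 prime[2] (ℕ.s≤s ℕ.z≤n) 1
      (subst (D₂ 1) value (D-neg 1 prime[2] (ℕ.s≤s ℕ.z≤n) 1 (Y-even (suc h ℕ.* 2)))))
    where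
    identity : ∀ x → - (0ℚ + - 1ℚ * (1ℚ + 0ℚ) + x * 0ℚ) ≡ 1ℚ
    identity = solve-∀ ℚ-ring
    value : - Y (suc h ℕ.* 2) ≡ ι (+ 1)
    value = trans (cong₂ (λ a b → - (0ℚ + - 1ℚ * (a + 0ℚ) + ι (+ 2) * b)) (ev-even (suc h)) B≡0)
        (trans (identity (ι (+ 2))) (sym ι-1))

open import Data.Nat using (ℕ; suc; _≤_)
open import Data.Nat.Primality using (Prime)

-- Products of blocks of p consecutive factors, modulo p and p².

module Blocks (q : ℕ) (pp : Prime (suc q)) (4≤q : 4 ≤ q) where
  open import Data.Nat as ℕ using (zero; _<_)
  open import Data.Nat.Primality using (prime⇒irreducible)
  import Data.Nat.Properties as ℕ
  import Data.Nat.Divisibility as ℕ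
  import Data.Nat.DivMod as ℕ
  open import Data.Integer using (ℤ; +_; -1ℤ; 0ℤ; 1ℤ; _+_; _*_; -_; _-_; _^_)
  open import Data.Integer.Properties
  open import Data.Integer.Divisibility.Signed
  open import Data.Integer.Tactic.RingSolver using (solve-∀)
  open import Data.Sum using (inj₁; inj₂)
  open import Data.Product using (∃; _,_)
  open import Data.Empty using (⊥-elim)
  open import Function using (_∘_)
  open import Relation.Nullary using (¬_; yes; no)
  open import Relation.Binary using (tri<; tri≈; tri>)
  open import Relation.Binary.PropositionalEquality
  open SymmetricFunctions
  open Shift
  open IntegerDivisibility
  open Bernoulli using (power-sum-p)
  open BernoulliNonzero using (even-or-odd)

  instance
    q≢0 : ℕ.NonZero q
    q≢0 = ℕ.>-nonZero (ℕ.≤-trans (ℕ.s≤s ℕ.z≤n) 4≤q)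

  0<q : 0 < q
  0<q = ℕ.≤-trans (ℕ.s≤s ℕ.z≤n) 4≤q

  p : ℕ
  p = suc q

  P : ℤ
  P = + p

  e : ℕ → ℤ
  e = E +_ p

  q-even : ∃ λ h → q ≡ h ℕ.* 2
  q-even with even-or-odd q
  ... | inj₁ even = even
  ... | inj₂ (h , q≡1+2h) with prime⇒irreducible pp (ℕ.divides (suc h) (cong suc q≡1+2h))
  ...   | inj₁ ()
  ...   | inj₂ 2≡p = ⊥-elim (ℕ.<⇒≢ (ℕ.s≤s (ℕ.≤-trans (ℕ.s≤s (ℕ.s≤s ℕ.z≤n)) 4≤q)) 2≡p)

  -1^q : -1ℤ ^ q ≡ 1ℤ
  -1^q = let h , q≡2h = q-even in trans (cong (-1ℤ ^_) q≡2h) (neg1-even h)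

  P*P∣ : ∀ {a b} → P ∣ a → P ∣ b → P ^ 2 ∣ a * b
  P*P∣ {a} {b} d d′ = subst (_∣ a * b) (cong (P *_) (sym (*-identityʳ P))) (*-∣-* d d′)

  cancel₁ : ∀ {c x} → ¬ (P ∣ c) → P ∣ c * x → P ∣ x
  cancel₁ {c} {x} p∤c d with prime-∣-* pp c x d
  ... | inj₁ p∣c = ⊥-elim (p∤c p∣c)
  ... | inj₂ p∣x = p∣x

  p∤6 : ¬ (P ∣ + 6)
  p∤6 = prime-∤-* pp {+ 2} {+ 3} (pos-∤ (ℕ.s≤s ℕ.z≤n) (ℕ.≤-trans (ℕ.s≤s (ℕ.s≤s (ℕ.s≤s ℕ.z≤n))) (ℕ.m≤n⇒m≤1+n 4≤q)))
                                 (pos-∤ (ℕ.s≤s ℕ.z≤n) (ℕ.m≤n⇒m≤1+n 4≤q))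

  e-drop0 : ∀ k → e k ≡ E (λ i → + suc i) q k
  e-drop0 k = trans (E-head +_ q k) (mulLin-0 _ k)

  e-> : ∀ {k} → q < k → e k ≡ 0ℤ
  e-> q<k = trans (e-drop0 _) (E-vanish (λ i → + suc i) q<k)

  -- In Newton's identity for k < q all exponents stay below p - 1, so p divides every power sum,
  -- and k is prime to p.
  e-small : ∀ k → 0 < k → k < q → P ∣ e k
  e-small (suc k) _ k<q = cancel₁ (pos-∤ ℕ.z<s (ℕ.m<n⇒m<1+n k<q))
    (subst (P ∣_) (sym (newton +_ p k)) (conv-∣ e (λ j → -1ℤ ^ j * power-sum +_ p (suc j)) k (λ i j i+j≡k →
      ∣n⇒∣m*n (e i) (∣n⇒∣m*n (-1ℤ ^ j)
        (power-sum-p q pp 0<q (suc j) (ℕ.≤-<-trans (ℕ.s≤s (subst (j ≤_) i+j≡k (ℕ.m≤n+m j i))) k<q))))))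

  -- In Newton's identity the terms e_i S_j with i ≥ 1 are products of two multiples of p. Only the
  -- term with e_0 = 1 survives modulo p².
  e-power-sum : ∀ m → suc (suc m) < q →
    P ^ 2 ∣ + suc (suc m) * e (suc (suc m)) - -1ℤ ^ suc m * power-sum +_ p (suc (suc m))
  e-power-sum m l<q = subst (P ^ 2 ∣_) (trans (identity (h (suc m)) rest) (cong (λ a → a - h (suc m))
      (sym (trans (newton +_ p (suc m)) (cong (λ a → a * h (suc m) + rest) (E-0 +_ p))))))
    (conv-∣ (e ∘ suc) h m (λ i j i+j≡m → P*P∣
      (e-small (suc i) ℕ.z<s (ℕ.≤-<-trans (ℕ.s≤s (ℕ.m≤n⇒m≤1+n (subst (i ≤_) i+j≡m (ℕ.m≤m+n i j)))) l<q))
      (∣n⇒∣m*n (-1ℤ ^ j) (power-sum-p q pp 0<q (suc j)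
          (ℕ.≤-<-trans (ℕ.s≤s (ℕ.m≤n⇒m≤1+n (subst (j ≤_) i+j≡m (ℕ.m≤n+m j i)))) l<q)))))
    where
    h : ℕ → ℤ
    h j = -1ℤ ^ j * power-sum +_ p (suc j)
    rest : ℤ
    rest = conv (e ∘ suc) h m
    identity : ∀ a b → b ≡ 1ℤ * a + b - a
    identity = solve-∀

  -- The factor 1 + t of ∏_{0<i<p} (1 + i t) makes the alternating sum of its coefficients vanish.
  alternating : ∀ n → 0 < n → conv (E (λ i → + suc i) n) (-1ℤ ^_) n ≡ 0ℤ
  alternating (suc n) _ = begin
    conv (E (λ i → + suc i) (suc n)) (-1ℤ ^_) (suc n)
      ≡⟨ conv-cong (E-head (λ i → + suc i) n) (λ _ → refl) (suc n) ⟩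
    conv (mulLin 1ℤ (E (λ i → + suc (suc i)) n)) (-1ℤ ^_) (suc n)
      ≡⟨ conv-geometric 1ℤ (E (λ i → + suc (suc i)) n) (suc n) ⟩
    E (λ i → + suc (suc i)) n (suc n)
      ≡⟨ E-vanish (λ i → + suc (suc i)) (ℕ.n<1+n n) ⟩
    0ℤ ∎
    where open ≡-Reasoning

  conv-δ₀+δ : ∀ c m g k → conv (λ i → δ 0 i + c * δ m i) g (m ℕ.+ k) ≡ g (m ℕ.+ k) + c * g k
  conv-δ₀+δ c m g k = trans (conv-linearˡ c (δ 0) (δ m) g (m ℕ.+ k))
    (cong₂ (λ a b → a + c * b) (conv-δ 0 g (m ℕ.+ k)) (conv-δ m g k))

  -- Wilson's theorem, as `e q` = (p - 1)!. Modulo p only the constant term and the coefficient of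
  -- t^q remain, and as q is even their alternating sum is 1 + `e q`, which vanishes by
  -- `alternating`.
  e-q : P ∣ e q - -1ℤ
  e-q = subst (P ∣_) (trans (cong₂ (λ a b → - (a - b)) conv-e conv-f) (identity (e q)))
          (∣m⇒∣-m (conv-approx e f (-1ℤ ^_) q
              (λ i j i+j≡q → ∣m⇒∣m*n (-1ℤ ^ j) (close i (subst (i ≤_) i+j≡q (ℕ.m≤m+n i j))))))
    where
    f : ℕ → ℤ
    f i = δ 0 i + e q * δ q i
    conv-e : conv e (-1ℤ ^_) q ≡ 0ℤ
    conv-e = trans (conv-cong e-drop0 (λ _ → refl) q) (alternating q 0<q)
    conv-f : conv f (-1ℤ ^_) q ≡ 1ℤ + e q * 1ℤ
    conv-f = trans (cong (conv f (-1ℤ ^_)) (sym (ℕ.+-identityʳ q)))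
      (trans (conv-δ₀+δ (e q) q (-1ℤ ^_) 0) (cong (_+ e q * 1ℤ) (trans (cong (-1ℤ ^_) (ℕ.+-identityʳ q)) -1^q)))
    identity : ∀ a → - (0ℤ - (1ℤ + a * 1ℤ)) ≡ a - -1ℤ
    identity = solve-∀
    at-0 : ∀ a → 1ℤ ≡ 1ℤ + a * 0ℤ
    at-0 = solve-∀
    at-q : ∀ a → a ≡ 0ℤ + a * 1ℤ
    at-q = solve-∀
    off : ∀ a b → a ≡ a - (0ℤ + b * 0ℤ)
    off = solve-∀
    close : ∀ i → i ≤ q → P ∣ e i - f i
    close i i≤q with i ℕ.≟ 0 | i ℕ.≟ q
    ... | yes refl | _ = ∣-reflexive-diff (trans (E-0 +_ p)
            (trans (at-0 (e q)) (cong (λ a → 1ℤ + e q * a) (sym (δ-off (ℕ.<⇒≢ 0<q))))))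
    ... | no i≢0 | yes refl = ∣-reflexive-diff (trans (at-q (e q))
            (cong₂ (λ a b → a + e q * b) (sym (δ-off i≢0)) (sym (δ-diag q))))
    ... | no i≢0 | no i≢q = subst (P ∣_)
            (trans (off (e i) (e q)) (cong₂ (λ a b → e i - (a + e q * b)) (sym (δ-off i≢0)) (sym (δ-off i≢q))))
            (e-small i (ℕ.n≢0⇒n>0 i≢0) (ℕ.≤∧≢⇒< i≤q i≢q))

  -- The factors 1 + i t with b p ≤ i < (b + 1) p.
  blk : ℕ → ℕ → ℤ
  blk b = E (λ i → + (b ℕ.* p ℕ.+ i)) p

  p∣start : ∀ b → P ∣ + (b ℕ.* p)
  p∣start b = ∣ᵤ⇒∣ (ℕ.n∣m*n b)

  blk-mod-p : ∀ b k → P ∣ blk b k - e k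
  blk-mod-p b k =
    let W , eq = E-shift₁ +_ (+ (b ℕ.* p)) p k
    in cancel₁ p∤6 (subst (P ∣_) (sym eq) (∣m∣n⇒∣m+n (∣m⇒∣m*n _ (p∣start b))
          (∣m⇒∣m*n W (∣m⇒∣m*n (+ (b ℕ.* p)) (p∣start b)))))

  -- The first-order term of the shift by b p contains e_{k-1}, which is itself divisible by p
  -- because 0 < k - 1 < q. This is where k ≥ 2 enters.
  blk-mod-p² : ∀ b k → 2 ≤ k → k < q → P ^ 2 ∣ blk b k - e k
  blk-mod-p² b (suc k) (ℕ.s≤s 0<k) k<q =
    let W , eq = E-shift₁ +_ (+ (b ℕ.* p)) p (suc k)
    in cancel-unit pp 2 p∤6 (subst (P ^ 2 ∣_) (sym eq)
         (∣m∣n⇒∣m+n (P*P∣ (p∣start b) (∣n⇒∣m*n (+ 6 * (+ p - + suc k + + 1))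
             (e-small k 0<k (ℕ.<-trans (ℕ.n<1+n k) k<q))))
                    (∣m⇒∣m*n W (P*P∣ (p∣start b) (p∣start b)))))

  blk-q : ∀ b → P ∣ blk b q - -1ℤ
  blk-q b = ∣-resp-trans {a = blk b q} {b = e q} {c = -1ℤ} (blk-mod-p b q) e-q

  blk-small : ∀ b i → 0 < i → i ≢ q → P ∣ blk b i
  blk-small b i 0<i i≢q with ℕ.<-cmp i q
  ... | tri< i<q _ _ = ∣-resp-+ {a = blk b i} {b = e i} (blk-mod-p b i) (e-small i 0<i i<q)
  ... | tri≈ _ i≡q _ = ⊥-elim (i≢q i≡q)
  ... | tri> _ _ q<i = ∣-resp-+ {a = blk b i} {b = e i} (blk-mod-p b i) (subst (P ∣_) (sym (e-> q<i)) ∣0)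

  -- F a k = s(a p, a p - k).
  F : ℕ → ℕ → ℤ
  F a = E +_ (a ℕ.* p)

  -- G a j = (-1)^j C(a, j).
  G : ℕ → ℕ → ℤ
  G = E (λ _ → -1ℤ)

  F-suc : ∀ a k → F (suc a) k ≡ conv (blk a) (F a) k
  F-suc a k = trans (cong (λ n → E +_ n k) (ℕ.+-comm p (a ℕ.* p))) (E-+ +_ (a ℕ.* p) p k)

  swap : ∀ r j → r ℕ.+ suc j ℕ.* q ≡ q ℕ.+ (r ℕ.+ j ℕ.* q)
  swap r j = trans (sym (ℕ.+-assoc r q (j ℕ.* q)))
    (trans (cong (ℕ._+ j ℕ.* q) (ℕ.+-comm r q)) (ℕ.+-assoc q r (j ℕ.* q)))

  -- Multiplication by 1 - t^q respects residue classes modulo q. On the class of r, read as a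
  -- series indexed by j, it is multiplication by 1 - t.
  conv-1-t^q : ∀ g r j → r < q → conv (λ i → δ 0 i + -1ℤ * δ q i) g (r ℕ.+ j ℕ.* q) ≡ mulLin -1ℤ
      (λ j → g (r ℕ.+ j ℕ.* q)) j
  conv-1-t^q g r zero r<q = begin
    conv (λ i → δ 0 i + -1ℤ * δ q i) g (r ℕ.+ 0)
      ≡⟨ conv-linearˡ -1ℤ (δ 0) (δ q) g (r ℕ.+ 0) ⟩
    conv (δ 0) g (r ℕ.+ 0) + -1ℤ * conv (δ q) g (r ℕ.+ 0)
      ≡⟨ cong₂ (λ a b → a + -1ℤ * b) (conv-δ 0 g (r ℕ.+ 0)) (conv-δ-< g (subst (_< q) (sym (ℕ.+-identityʳ r)) r<q)) ⟩
    g (r ℕ.+ 0) + 0ℤ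
      ≡⟨ +-identityʳ _ ⟩
    g (r ℕ.+ 0) ∎
    where open ≡-Reasoning
  conv-1-t^q g r (suc j) r<q = begin
    conv f g (r ℕ.+ suc j ℕ.* q)
      ≡⟨ cong (conv f g) (swap r j) ⟩
    conv f g (q ℕ.+ (r ℕ.+ j ℕ.* q))
      ≡⟨ conv-δ₀+δ -1ℤ q g (r ℕ.+ j ℕ.* q) ⟩
    g (q ℕ.+ (r ℕ.+ j ℕ.* q)) + -1ℤ * g (r ℕ.+ j ℕ.* q)
      ≡⟨ cong (λ m → g m + -1ℤ * g (r ℕ.+ j ℕ.* q)) (swap r j) ⟨
    g (r ℕ.+ suc j ℕ.* q) + -1ℤ * g (r ℕ.+ j ℕ.* q) ∎
    where
    open ≡-Reasoning
    f : ℕ → ℤ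
    f i = δ 0 i + -1ℤ * δ q i

  F-step : ∀ a r j → r < q → P ∣ F (suc a) (r ℕ.+ j ℕ.* q) - mulLin -1ℤ (λ j → F a (r ℕ.+ j ℕ.* q)) j
  F-step a r j r<q = subst (P ∣_) (cong₂ _-_ (sym (F-suc a (r ℕ.+ j ℕ.* q))) (conv-1-t^q (F a) r j r<q))
    (conv-approx (blk a) f (F a) (r ℕ.+ j ℕ.* q) (λ i i′ _ → ∣m⇒∣m*n (F a i′) (close i)))
    where
    f : ℕ → ℤ
    f i = δ 0 i + -1ℤ * δ q i
    off : ∀ a → a ≡ a - (0ℤ + -1ℤ * 0ℤ)
    off = solve-∀
    close : ∀ i → P ∣ blk a i - f i
    close i with i ℕ.≟ 0 | i ℕ.≟ q
    ... | yes refl | _ = ∣-reflexive-diff (trans (E-0 (λ i → + (a ℕ.* p ℕ.+ i)) p)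
        (cong (λ b → 1ℤ + -1ℤ * b) (sym (δ-off (ℕ.<⇒≢ 0<q)))))
    ... | no i≢0 | yes refl = subst (λ b → P ∣ blk a i - b) (cong₂ (λ b c → b + -1ℤ * c) (sym (δ-off i≢0))
        (sym (δ-diag q))) (blk-q a)
    ... | no i≢0 | no i≢q = subst (P ∣_)
        (trans (off (blk a i)) (cong₂ (λ b c → blk a i - (b + -1ℤ * c)) (sym (δ-off i≢0)) (sym (δ-off i≢q))))
                              (blk-small a i (ℕ.n≢0⇒n>0 i≢0) i≢q)

  -- By `F-step` with r = 0 each block acts as 1 - t on the multiples of q, so that class carries (1
  -- - t)^a.
  F-multiple : ∀ a j → P ∣ F a (j ℕ.* q) - G a j
  F-multiple zero    zero    = ∣0
  F-multiple zero    (suc j) = ∣-reflexive-diff (δ-off (λ eq → ℕ.<⇒≢ 0<q (sym (ℕ.m+n≡0⇒m≡0 q eq))))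
  F-multiple (suc a) j = ∣-resp-trans {a = F (suc a) (j ℕ.* q)} {b = mulLin -1ℤ (λ j → F a (j ℕ.* q)) j} {c =
      G (suc a) j} (F-step a 0 j 0<q) (mulLin-∣ -1ℤ (F-multiple a) j)

  F-residue : ∀ a r j → 0 < r → r < q → P ∣ F a (r ℕ.+ j ℕ.* q)
  F-residue zero    r j 0<r r<q = subst (P ∣_) (sym (δ-off (λ eq → ℕ.<⇒≢ 0<r (sym (ℕ.m+n≡0⇒m≡0 r eq))))) ∣0
  F-residue (suc a) r j 0<r r<q = ∣-resp-+ {a = F (suc a) (r ℕ.+ j ℕ.* q)} {b = mulLin -1ℤ
      (λ j → F a (r ℕ.+ j ℕ.* q)) j} (F-step a r j r<q) (div j)
    where
    div : ∀ j → P ∣ mulLin -1ℤ (λ j → F a (r ℕ.+ j ℕ.* q)) j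
    div zero    = F-residue a r zero 0<r r<q
    div (suc j) = ∣m∣n⇒∣m+n (F-residue a r (suc j) 0<r r<q) (∣n⇒∣m*n -1ℤ (F-residue a r j 0<r r<q))

  F-∤ : ∀ a k → ¬ (q ℕ.∣ k) → P ∣ F a k
  F-∤ a k q∤k = subst (λ m → P ∣ F a m) (sym (ℕ.m≡m%n+[m/n]*n k q))
    (F-residue a (k ℕ.% q) (k ℕ./ q) (ℕ.n≢0⇒n>0 (q∤k ∘ ℕ.m%n≡0⇒n∣m k q)) (ℕ.m%n<n k q))

  G-absorb : ∀ a j → + suc j * G (suc a) (suc j) ≡ - (+ suc a) * G a j
  G-absorb zero    zero    = refl
  G-absorb zero    (suc j) = *-zeroʳ (+ suc (suc j))
  G-absorb (suc a) zero    = trans (identity (G (suc a) 1) (G a 0))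
      (trans (cong (λ b → b - G a 0) (G-absorb a zero)) (identity′ (+ suc a) (G a 0)))
    where
    identity : ∀ b c → 1ℤ * (b + -1ℤ * c) ≡ 1ℤ * b - c
    identity = solve-∀
    identity′ : ∀ m b → - m * b - b ≡ - (1ℤ + m) * b
    identity′ = solve-∀
  G-absorb (suc a) (suc j) = trans (identity (+ suc j) (G (suc a) (suc (suc j))) (G (suc a) (suc j)))
      (trans (cong₂ (λ b c → b - c - G (suc a) (suc j)) (G-absorb a (suc j)) (G-absorb a j))
          (identity′ (+ suc a) (G a (suc j)) (G a j)))
    where
    identity : ∀ m b c → (1ℤ + m) * (b + -1ℤ * c) ≡ (1ℤ + m) * b - m * c - c
    identity = solve-∀
    identity′ : ∀ m b c → - m * b - - m * c - (b + -1ℤ * c) ≡ - (1ℤ + m) * (b + -1ℤ * c)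
    identity′ = solve-∀

  -- The absorption identity writes (j + 1) times the coefficient as a product of - (a + 1) and
  -- `G a j`. Both are prime to p, the first because a + 1 < p.
  G-unit : ∀ a j → j ≤ a → a < p → ¬ (P ∣ G a j)
  G-unit a       zero    _   _   d = pos-∤ ℕ.z<s (ℕ.s≤s 0<q) (subst (P ∣_) (E-0 (λ _ → -1ℤ) a) d)
  G-unit (suc a) (suc j) (ℕ.s≤s j≤a) a<p d =
    prime-∤-* pp { - (+ suc a)} {G a j} (λ d′ → pos-∤ ℕ.z<s a<p (subst (P ∣_) (neg-involutive (+ suc a)) (∣m⇒∣-m d′)))
      (G-unit a j j≤a (ℕ.<-trans (ℕ.n<1+n a) a<p)) (subst (P ∣_) (G-absorb a j) (∣n⇒∣m*n (+ suc j) d))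

  -- In the residue class of l each block may be replaced by 1 - t^q + e_l t^l. As p divides e_l,
  -- the product of a blocks is (1 - t^q)^a + a e_l t^l (1 - t^q)^(a-1) modulo p², and only the
  -- second summand meets this class.
  F-mod-p² : ∀ l → 2 ≤ l → l < q → ∀ a j → P ^ 2 ∣ F a (l ℕ.+ j ℕ.* q) - + a * G (ℕ.pred a) j * e l
  F-mod-p² l 2≤l l<q zero    j = ∣-reflexive-diff
      (δ-off (λ eq → ℕ.<⇒≢ (ℕ.<-trans ℕ.z<s 2≤l) (sym (ℕ.m+n≡0⇒m≡0 l eq))))
  F-mod-p² l 2≤l l<q (suc a) j = ∣-resp-trans {a = F (suc a) k} {b = X} {c = + suc a * G a j * e l} step
      (∣-resp-trans {a = X} {b = Y} {c = + suc a * G a j * e l} step₁ step₂)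
    where
    k : ℕ
    k = l ℕ.+ j ℕ.* q
    0<l : 0 < l
    0<l = ℕ.<-trans ℕ.z<s 2≤l
    f : ℕ → ℤ
    f i = δ 0 i + -1ℤ * δ q i + e l * δ l i
    Fl : ℕ → ℤ
    Fl j = F a (l ℕ.+ j ℕ.* q)
    X Y : ℤ
    X = mulLin -1ℤ Fl j + e l * F a (j ℕ.* q)
    Y = mulLin -1ℤ (λ j → + a * G (ℕ.pred a) j * e l) j + e l * G a j
    expand : conv f (F a) k ≡ mulLin -1ℤ Fl j + e l * F a (j ℕ.* q)
    expand = trans (conv-linearˡ (e l) (λ i → δ 0 i + -1ℤ * δ q i) (δ l) (F a) k)
      (cong₂ (λ b c → b + e l * c) (conv-1-t^q (F a) l j l<q) (conv-δ l (F a) (j ℕ.* q)))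
    %q : ∀ m → (l ℕ.+ m ℕ.* q) ℕ.% q ≡ l
    %q m = trans (ℕ.[m+kn]%n≡m%n l m q) (ℕ.m<n⇒m%n≡m l<q)
    at-0 : ∀ c → 1ℤ ≡ 1ℤ + -1ℤ * 0ℤ + c * 0ℤ
    at-0 = solve-∀
    at-q : ∀ c → -1ℤ ≡ 0ℤ + -1ℤ * 1ℤ + c * 0ℤ
    at-q = solve-∀
    at-l : ∀ c → c ≡ 0ℤ + -1ℤ * 0ℤ + c * 1ℤ
    at-l = solve-∀
    off : ∀ b c → b ≡ b - (0ℤ + -1ℤ * 0ℤ + c * 0ℤ)
    off = solve-∀
    f-value : ∀ {i x y z} → δ 0 i ≡ x → δ q i ≡ y → δ l i ≡ z → x + -1ℤ * y + e l * z ≡ f i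
    f-value refl refl refl = refl
    close : ∀ i i′ → i ℕ.+ i′ ≡ k → P ^ 2 ∣ (blk a i - f i) * F a i′
    close i i′ i+i′≡k with i ℕ.≟ 0 | i ℕ.≟ q | i ℕ.≟ l
    ... | yes refl | _ | _ = ∣m⇒∣m*n (F a i′) (∣-reflexive-diff (trans (E-0 (λ i → + (a ℕ.* p ℕ.+ i)) p)
            (trans (at-0 (e l)) (f-value refl (δ-off (ℕ.<⇒≢ 0<q)) (δ-off (ℕ.<⇒≢ 0<l))))))
    -- The coefficient of t^q is known modulo p only. The cofactor has index i′ congruent to l
    -- modulo q and supplies the second p.
    ... | no i≢0 | yes refl | _ = P*P∣
            (subst (λ b → P ∣ blk a q - b)
                (trans (at-q (e l)) (f-value (δ-off i≢0) (δ-diag q) (δ-off (ℕ.<⇒≢ l<q ∘ sym)))) (blk-q a))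
            (F-∤ a i′ (λ q∣i′ → ℕ.<⇒≢ 0<l (sym
                (trans (sym (%q j)) (trans (cong (ℕ._% q) (sym i+i′≡k))
                (ℕ.n∣m⇒m%n≡0 _ q (ℕ.∣m∣n⇒∣m+n ℕ.∣-refl q∣i′)))))))
    ... | no i≢0 | no i≢q | yes refl = ∣m⇒∣m*n (F a i′)
            (subst (λ b → P ^ 2 ∣ blk a l - b)
                (trans (at-l (e l)) (f-value (δ-off i≢0) (δ-off i≢q) (δ-diag l))) (blk-mod-p² a l 2≤l l<q))
    -- Both factors are multiples of p unless q divides i′. Then i is congruent to l modulo q, so i
    -- ≠ l forces i > q: for i = p this would mean l = 1, and for i > p the coefficient is 0.
    ... | no i≢0 | no i≢q | no i≢l = subst (λ b → P ^ 2 ∣ b * F a i′)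
            (trans (off (blk a i) (e l)) (cong (λ b → blk a i - b)
                (f-value (δ-off i≢0) (δ-off i≢q) (δ-off i≢l)))) (both (q ℕ.∣? i′))
      where
      i%q≡l : q ℕ.∣ i′ → i ℕ.% q ≡ l
      i%q≡l (ℕ.divides m refl) = trans (sym (ℕ.[m+kn]%n≡m%n i m q)) (trans (cong (ℕ._% q) i+i′≡k) (%q j))
      both : _ → P ^ 2 ∣ blk a i * F a i′
      both (no q∤i′) = P*P∣ (blk-small a i (ℕ.n≢0⇒n>0 i≢0) i≢q) (F-∤ a i′ q∤i′)
      both (yes q∣i′) with ℕ.<-cmp i q
      ... | tri< i<q _ _ = ⊥-elim (i≢l (trans (sym (ℕ.m<n⇒m%n≡m i<q)) (i%q≡l q∣i′)))
      ... | tri≈ _ i≡q _ = ⊥-elim (i≢q i≡q)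
      ... | tri> _ _ (ℕ.s≤s q≤i) with ℕ.m≤n⇒m<n∨m≡n q≤i
      ...   | inj₁ p≤i₀ = subst (P ^ 2 ∣_)
          (sym (cong (_* F a i′) (E-vanish (λ i → + (a ℕ.* p ℕ.+ i)) (ℕ.s≤s p≤i₀)))) ∣0
      ...   | inj₂ refl = ⊥-elim (ℕ.<⇒≢ 2≤l (trans (sym 1%q) (i%q≡l q∣i′)))
        where
        1%q : suc q ℕ.% q ≡ 1
        1%q = trans (ℕ.[m+n]%n≡m%n 1 q) (ℕ.m<n⇒m%n≡m (ℕ.≤-trans (ℕ.s≤s (ℕ.s≤s ℕ.z≤n)) 4≤q))
    step : P ^ 2 ∣ F (suc a) k - (mulLin -1ℤ Fl j + e l * F a (j ℕ.* q))
    step = subst (P ^ 2 ∣_) (cong₂ _-_ (sym (F-suc a k)) expand) (conv-approx (blk a) f (F a) k close)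
    step₁ : P ^ 2 ∣ mulLin -1ℤ Fl j + e l * F a (j ℕ.* q) -
        (mulLin -1ℤ (λ j → + a * G (ℕ.pred a) j * e l) j + e l * G a j)
    step₁ = subst (P ^ 2 ∣_) (identity (mulLin -1ℤ Fl j) (mulLin -1ℤ (λ j → + a * G (ℕ.pred a) j * e l) j)
        (e l) (F a (j ℕ.* q)) (G a j))
      (∣m∣n⇒∣m+n (mulLin-∣ -1ℤ (F-mod-p² l 2≤l l<q a) j) (P*P∣ (e-small l 0<l l<q) (F-multiple a j)))
      where
      identity : ∀ b c x y z → b - c + x * (y - z) ≡ b + x * y - (c + x * z)
      identity = solve-∀
    step₂ : P ^ 2 ∣ mulLin -1ℤ (λ j → + a * G (ℕ.pred a) j * e l) j + e l * G a j - + suc a * G a j * e l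
    step₂ = ∣-reflexive-diff (derivative a j)
      where
      -- The product rule for the derivative of x^(a+1) at x = 1 - t: x times a x^(a-1), plus x^a,
      -- is (a + 1) x^a.
      derivative : ∀ a j → mulLin -1ℤ (λ j → + a * G (ℕ.pred a) j * e l) j + e l * G a j ≡ + suc a * G a j * e l
      derivative zero    zero    = identity (e l)
        where
        identity : ∀ x → + 0 + x * 1ℤ ≡ 1ℤ * x
        identity = solve-∀
      derivative zero    (suc j) = identity (e l)
        where
        identity : ∀ x → + 0 + x * 0ℤ ≡ 0ℤ * x
        identity = solve-∀
      derivative (suc a) zero    = identity (+ suc a) (G a 0) (e l)
        where
        identity : ∀ m g x → m * g * x + x * g ≡ (1ℤ + m) * g * x
        identity = solve-∀
      derivative (suc a) (suc j) = identity (+ suc a) (G a (suc j)) (G a j) (e l)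
        where
        identity : ∀ m g h x → m * g * x + -1ℤ * (m * h * x) + x * (g + -1ℤ * h) ≡ (1ℤ + m) * (g + -1ℤ * h) * x
        identity = solve-∀

  -- Each block has degree at most p = q + 1, so a monomial of degree at least a q + r takes t^p
  -- from at least r of the a blocks, each time with a coefficient divisible by p.
  F-high : ∀ a r k → a ℕ.* q ℕ.+ r ≤ k → P ^ r ∣ F a k
  F-high a       zero    k       _  = divides (F a k) (sym (*-identityʳ (F a k)))
  F-high zero    (suc r) (suc k) _  = ∣0
  F-high (suc a) (suc r) k       le = subst (P ^ suc r ∣_) (sym (F-suc a k)) (conv-∣ (blk a) (F a) k term)
    where
    term : ∀ i i′ → i ℕ.+ i′ ≡ k → P ^ suc r ∣ blk a i * F a i′
    term i i′ refl with ℕ.<-cmp i p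
    ... | tri< (ℕ.s≤s i≤q) _ _ = ∣n⇒∣m*n (blk a i) (F-high a (suc r) i′
            (ℕ.+-cancelˡ-≤ q _ _ (subst (_≤ q ℕ.+ i′) (ℕ.+-assoc q (a ℕ.* q) (suc r))
                (ℕ.≤-trans le (ℕ.+-monoˡ-≤ i′ i≤q)))))
    ... | tri≈ _ refl _ = *-∣-* (blk-small a p ℕ.z<s (ℕ.<⇒≢ (ℕ.n<1+n q) ∘ sym)) (F-high a r i′
            (ℕ.+-cancelˡ-≤ (suc q) _ _ (subst (_≤ suc q ℕ.+ i′) (trans (ℕ.+-suc (q ℕ.+ a ℕ.* q) r)
                (cong suc (ℕ.+-assoc q (a ℕ.* q) r))) le)))
    ... | tri> _ _ p<i = subst (P ^ suc r ∣_) (sym (cong (_* F a i′) (E-vanish (λ i → + (a ℕ.* p ℕ.+ i)) p<i))) ∣0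

-- Stirling numbers as elementary symmetric functions.

module Stirling where
  open import Defs
  open import Data.Nat as ℕ using (ℕ; zero; suc)
  import Data.Nat.Properties as ℕ
  open import Data.Integer using (+_; _+_; _*_)
  open import Data.Integer.Properties using (pos-*; +-identityˡ)
  open import Data.List using ([]; _∷_)
  open import Relation.Binary.PropositionalEquality
  open SymmetricFunctions

  coeff-addP : ∀ k f g → coeff k (addP f g) ≡ coeff k f ℕ.+ coeff k g
  coeff-addP k       []      g       = refl
  coeff-addP k       (x ∷ f) []      = sym (ℕ.+-identityʳ _)
  coeff-addP zero    (x ∷ f) (y ∷ g) = refl
  coeff-addP (suc k) (x ∷ f) (y ∷ g) = coeff-addP k f g

  coeff-scale : ∀ k c f → coeff k (scale c f) ≡ c ℕ.* coeff k f
  coeff-scale k       c []      = sym (ℕ.*-zeroʳ c)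
  coeff-scale zero    c (x ∷ f) = refl
  coeff-scale (suc k) c (x ∷ f) = coeff-scale k c f

  stirling1-suc : ∀ n j → stirling1 (suc n) (suc j) ≡ stirling1 n j ℕ.+ n ℕ.* stirling1 n (suc j)
  stirling1-suc n j = trans (coeff-addP (suc j) (0 ∷ rising n) (scale n (rising n)))
      (cong (stirling1 n j ℕ.+_) (coeff-scale (suc j) n (rising n)))

  stirling1-zero : ∀ n → stirling1 (suc n) 0 ≡ n ℕ.* stirling1 n 0
  stirling1-zero n = trans (coeff-addP 0 (0 ∷ rising n) (scale n (rising n))) (coeff-scale 0 n (rising n))

  stirling1-> : ∀ n j → n ℕ.< j → stirling1 n j ≡ 0
  stirling1-> zero    (suc j) _           = refl
  stirling1-> (suc n) (suc j) (ℕ.s≤s n<j) = trans (stirling1-suc n j)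
    (trans (cong₂ (λ a b → a ℕ.+ n ℕ.* b) (stirling1-> n j n<j) (stirling1-> n (suc j) (ℕ.m<n⇒m<1+n n<j)))
        (ℕ.*-zeroʳ n))

  -- Excludes the junk value `vp p 0` = 0, so that divisibility statements translate into
  -- valuations.
  stirling1-pos : ∀ n j → 0 ℕ.< j → j ℕ.≤ n → 0 ℕ.< stirling1 n j
  stirling1-pos (suc zero)    (suc zero)    _ _           = ℕ.z<s
  stirling1-pos (suc (suc n)) (suc zero)    _ _           = subst (0 ℕ.<_) (sym (stirling1-suc (suc n) 0))
    (ℕ.<-≤-trans (stirling1-pos (suc n) 1 ℕ.z<s (ℕ.s≤s ℕ.z≤n))
        (ℕ.≤-trans (ℕ.m≤m+n _ (n ℕ.* stirling1 (suc n) 1)) (ℕ.m≤n+m _ (stirling1 (suc n) 0))))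
  stirling1-pos (suc n)       (suc (suc j)) _ (ℕ.s≤s j≤n) = subst (0 ℕ.<_) (sym (stirling1-suc n (suc j)))
    (ℕ.<-≤-trans (stirling1-pos n (suc j) ℕ.z<s j≤n) (ℕ.m≤m+n _ (n ℕ.* stirling1 n (suc (suc j)))))

  -- Read from the top coefficient downwards, multiplication by x + n becomes multiplication by 1 +
  -- n t.
  stirling1-E : ∀ n j k → j ℕ.+ k ≡ n → + stirling1 n j ≡ E +_ n k
  stirling1-E zero    zero    zero    refl = refl
  stirling1-E (suc n) zero    (suc k) refl = trans (cong +_ (stirling1-zero n)) (trans (pos-* n (stirling1 n 0))
    (trans (cong (+ n *_) (stirling1-E n zero n refl))
        (sym (trans (cong (_+ + n * E +_ n n) (E-vanish +_ (ℕ.n<1+n n))) (+-identityˡ (+ n * E +_ n n))))))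
  stirling1-E (suc n) (suc j) zero    eq   = trans
      (cong +_ (trans (stirling1-suc n j) (cong (λ a → stirling1 n j ℕ.+ n ℕ.* a)
    (stirling1-> n (suc j) (ℕ.≤-reflexive (sym (trans (sym (ℕ.+-identityʳ (suc j))) eq)))))))
    (trans (cong +_ (trans (cong (stirling1 n j ℕ.+_) (ℕ.*-zeroʳ n)) (ℕ.+-identityʳ _)))
        (stirling1-E n j zero (ℕ.suc-injective eq)))
  stirling1-E (suc n) (suc j) (suc k) eq   = trans (cong +_ (stirling1-suc n j))
      (cong₂ _+_ (stirling1-E n j (suc k) (ℕ.suc-injective eq))
    (trans (pos-* n (stirling1 n (suc j)))
        (cong (+ n *_) (stirling1-E n (suc j) k (trans (sym (ℕ.+-suc j k)) (ℕ.suc-injective eq))))))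

-- The symmetry of the roots for odd index.

module Reflection where
  open import Data.Nat as ℕ using (ℕ; suc)
  open import Data.Integer hiding (suc)
  open import Data.Integer.Tactic.RingSolver using (solve-∀)
  open import Data.Product using (∃; _,_)
  open import Relation.Binary.PropositionalEquality
  open SymmetricFunctions
  open Shift
  open IntegerDivisibility using (neg1-even)

  -- {1, …, N} is invariant under i ↦ N + 1 - i, so for odd k the leading terms of the expansion
  -- in powers of N + 1 determine 2 e_k.
  reflection : ∀ N h → ∃ λ Z →
    + 12 * E +_ (suc N) (3 ℕ.+ h ℕ.* 2) ≡
    (+ suc N - + (3 ℕ.+ h ℕ.* 2)) * + suc N *
      (+ 6 * E +_ (suc N) (2 ℕ.+ h ℕ.* 2)
       - + 3 * (+ N - + (3 ℕ.+ h ℕ.* 2) + + 2) * + suc N * E +_ (suc N) (1 ℕ.+ h ℕ.* 2)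
       + (+ N - + (3 ℕ.+ h ℕ.* 2) + + 3) * (+ N - + (3 ℕ.+ h ℕ.* 2) + + 2) * + suc N * + suc N * E +_ (suc N)
           (h ℕ.* 2))
    + + suc N * + suc N * + suc N * + suc N * Z
  reflection N h with E-shift (λ i → - (+ suc i)) (+ suc N) N (3 ℕ.+ h ℕ.* 2)
  -- One half of `+ 12 * F k` is expanded through the reflection. For odd k its leading term is -6 F
  -- k, which cancels the other half.
  ... | Z , eq = Z , (begin
    + 12 * F k
      ≡⟨ double (F k) ⟩
    + 6 * F k + + 6 * F k
      ≡⟨ cong (λ a → + 6 * a + + 6 * F k) (reflected k) ⟩
    + 6 * E (λ i → Y + ψ i) N k + + 6 * F k
      ≡⟨ cong (_+ + 6 * F k) eq ⟩
    taylor₃ Y d (E ψ N k) (E ψ N (2 ℕ.+ h ℕ.* 2)) (E ψ N (1 ℕ.+ h ℕ.* 2))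
        (E ψ N (h ℕ.* 2)) + Y * Y * Y * Y * Z + + 6 * F k
      ≡⟨ cong (λ t → t + Y * Y * Y * Y * Z + + 6 * F k) (values (signed k) (signed (2 ℕ.+ h ℕ.* 2))
          (signed (1 ℕ.+ h ℕ.* 2)) (signed (h ℕ.* 2))) ⟩
    taylor₃ Y d (-1ℤ ^ k * F k) (-1ℤ ^ (2 ℕ.+ h ℕ.* 2) * F (2 ℕ.+ h ℕ.* 2))
        (-1ℤ ^ (1 ℕ.+ h ℕ.* 2) * F (1 ℕ.+ h ℕ.* 2)) (-1ℤ ^ (h ℕ.* 2) * F (h ℕ.* 2))
    + Y * Y * Y * Y * Z + + 6 * F k
      ≡⟨ cong (λ s → taylor₃ Y d (-1ℤ * (-1ℤ * (-1ℤ * s)) * F k) (-1ℤ * (-1ℤ * s) * F (2 ℕ.+ h ℕ.* 2))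
          (-1ℤ * s * F (1 ℕ.+ h ℕ.* 2)) (s * F (h ℕ.* 2)) + Y * Y * Y * Y * Z + + 6 * F k) (neg1-even h) ⟩
    taylor₃ Y d (-1ℤ * F k) (1ℤ * F (2 ℕ.+ h ℕ.* 2)) (-1ℤ * F (1 ℕ.+ h ℕ.* 2))
        (1ℤ * F (h ℕ.* 2)) + Y * Y * Y * Y * Z + + 6 * F k
      ≡⟨ identity (+ N) (+ k) (F k) (F (2 ℕ.+ h ℕ.* 2)) (F (1 ℕ.+ h ℕ.* 2)) (F (h ℕ.* 2)) Z ⟩
    _ ∎)
    where
    open ≡-Reasoning
    k : ℕ
    k = 3 ℕ.+ h ℕ.* 2
    Y d : ℤ
    Y = + suc N
    d = + N - + k
    F : ℕ → ℤ
    F = E +_ (suc N)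
    ψ : ℕ → ℤ
    ψ i = - (+ suc i)
    drop0 : ∀ j → F j ≡ E (λ i → + suc i) N j
    drop0 j = trans (E-head +_ N j) (mulLin-0 _ j)
    shift : ∀ n i → 1ℤ + n - 1ℤ - i ≡ 1ℤ + n + - (1ℤ + i)
    shift = solve-∀
    reflected : ∀ j → F j ≡ E (λ i → Y + ψ i) N j
    reflected j = trans (drop0 j) (trans (E-reverse 1ℤ N j) (E-cong (λ i → shift (+ N) (+ i)) N j))
    signed : ∀ j → E ψ N j ≡ -1ℤ ^ j * F j
    signed j = trans (E-neg (λ i → + suc i) N j) (cong (-1ℤ ^ j *_) (sym (drop0 j)))
    values : ∀ {p₃ p₂ p₁ p₀ q₃ q₂ q₁ q₀} → p₃ ≡ q₃ → p₂ ≡ q₂ → p₁ ≡ q₁ → p₀ ≡ q₀ → taylor₃ Y d p₃ p₂ p₁ p₀ ≡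
        taylor₃ Y d q₃ q₂ q₁ q₀
    values refl refl refl refl = refl
    double : ∀ a → + 12 * a ≡ + 6 * a + + 6 * a
    double = solve-∀
    identity : ∀ N k f₃ f₂ f₁ f₀ Z →
      + 6 * (-1ℤ * f₃) + + 6 * (N - k + + 1) * (1ℤ + N) * (1ℤ * f₂) + + 3 * (N - k + + 2) * (N - k + + 1) *
          (1ℤ + N) * (1ℤ + N) * (-1ℤ * f₁)
      + (N - k + + 3) * (N - k + + 2) * (N - k + + 1) * (1ℤ + N) * (1ℤ + N) * (1ℤ + N) * (1ℤ * f₀)
      + (1ℤ + N) * (1ℤ + N) * (1ℤ + N) * (1ℤ + N) * Z + + 6 * f₃
      ≡ (1ℤ + N - k) * (1ℤ + N) * (+ 6 * f₂ - + 3 * (N - k + + 2) * (1ℤ + N) * f₁ + (N - k + + 3) *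
          (N - k + + 2) * (1ℤ + N) * (1ℤ + N) * f₀)
        + (1ℤ + N) * (1ℤ + N) * (1ℤ + N) * (1ℤ + N) * Z
    identity = solve-∀

-- Valuations for a fixed a: even indices, odd indices, congruences modulo p - 1.

module Valuations (q : ℕ) (pp : Prime (suc q)) (4≤q : 4 ≤ q) (a′ : ℕ) (a≤q : suc a′ ≤ q) where
  open import Defs
  open import Data.Nat as ℕ using (zero; _<_; z≤n; s≤s; _∸_)
  import Data.Nat.Properties as ℕ
  import Data.Nat.Divisibility as ℕ
  import Data.Nat.DivMod as ℕ
  open import Data.Integer as ℤ using (ℤ; +_; -1ℤ; 1ℤ; _+_; _*_; -_; _-_; _^_)
  open import Data.Integer.Properties
  open import Data.Integer.Divisibility.Signed
  open import Data.Integer.Tactic.RingSolver using (solve-∀)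
  open import Data.Product using (∃; _×_; _,_; proj₁; proj₂)
  open import Data.Sum using (inj₁; inj₂)
  open import Data.Empty using (⊥-elim)
  open import Function using (_⇔_; mk⇔)
  open import Relation.Nullary using (¬_; yes; no)
  open import Relation.Binary.PropositionalEquality
  open SymmetricFunctions
  open IntegerDivisibility
  open Valuation
  open PIntegral
  open Bernoulli
  open BernoulliNonzero
  open Stirling
  open Reflection
  open Blocks q pp 4≤q

  a n : ℕ
  a = suc a′
  n = a ℕ.* p

  f : ℕ → ℤ
  f = F a

  p∤a : ¬ (P ∣ + a)
  p∤a = pos-∤ ℕ.z<s (s≤s a≤q)

  pos-^ : ∀ r → (+ p) ^ r ≡ + (p ℕ.^ r)
  pos-^ zero    = refl
  pos-^ (suc r) = trans (cong (P *_) (pos-^ r)) (sym (pos-* p (p ℕ.^ r)))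

  ∣ᵤ⇒∣-^ : ∀ r {m} → p ℕ.^ r ℕ.∣ m → P ^ r ∣ + m
  ∣ᵤ⇒∣-^ r d = subst (_∣ _) (sym (pos-^ r)) (∣ᵤ⇒∣ d)

  ∣⇒∣ᵤ-^ : ∀ r {m} → P ^ r ∣ + m → p ℕ.^ r ℕ.∣ m
  ∣⇒∣ᵤ-^ r d = ∣⇒∣ᵤ (subst (_∣ _) (pos-^ r) d)

  v : ℕ → ℕ
  v k = vp p (stirling1 n (n ∸ k))

  module _ {k} (k<n : k < n) where
    private
      +s≡f : + stirling1 n (n ∸ k) ≡ f k
      +s≡f = stirling1-E n (n ∸ k) k (ℕ.m∸n+n≡m (ℕ.<⇒≤ k<n))

      s-pos : 0 < stirling1 n (n ∸ k)
      s-pos = stirling1-pos n (n ∸ k) (ℕ.m<n⇒0<n∸m k<n) (ℕ.m∸n≤m n k)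

    v-lower : ∀ r → P ^ r ∣ f k → r ≤ v k
    v-lower r d = vp-lower q 0<q r s-pos (∣⇒∣ᵤ-^ r (subst (P ^ r ∣_) (sym +s≡f) d))

    v-exact : ∀ r → P ^ r ∣ f k → ¬ (P ^ suc r ∣ f k) → v k ≡ r
    v-exact r d nd = ℕ.≤-antisym (vp-upper q 0<q r s-pos
        (λ d′ → nd (subst (P ^ suc r ∣_) +s≡f (∣ᵤ⇒∣-^ (suc r) d′)))) (v-lower r d)

  %2-even : ∀ h → (h ℕ.* 2) ℕ.% 2 ≡ 0
  %2-even h = ℕ.m*n%n≡0 h 2

  %2-odd : ∀ h → suc (h ℕ.* 2) ℕ.% 2 ≡ 1
  %2-odd h = ℕ.[m+kn]%n≡m%n 1 h 2

  +jq-%2 : ∀ l j → (l ℕ.+ j ℕ.* q) ℕ.% 2 ≡ l ℕ.% 2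
  +jq-%2 l j = let h , q≡2h = q-even in
    trans (cong (λ m → (l ℕ.+ m) ℕ.% 2) (trans (cong (j ℕ.*_) q≡2h) (sym (ℕ.*-assoc j h 2))))
        (ℕ.[m+kn]%n≡m%n l (j ℕ.* h) 2)

  q∤odd : ∀ h → ¬ (q ℕ.∣ suc (h ℕ.* 2))
  q∤odd h (ℕ.divides j eq) with () ← trans (sym (%2-odd h)) (trans (cong (ℕ._% 2) eq) (+jq-%2 0 j))

  -- Modulo p the value is a signed binomial coefficient C(a, j) with a < p.
  f-multiple-unit : ∀ k → suc (suc k) ≤ n → q ℕ.∣ k → ¬ (P ∣ f k)
  f-multiple-unit _ le (ℕ.divides j refl) d = G-unit a j (ℕ.≮⇒≥ j≯a) (s≤s a≤q)
      (∣-resp-+′ {a = f (j ℕ.* q)} {b = G a j} (F-multiple a j) d)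
    where
    -- From j ≥ a + 1 and j q + 2 ≤ a p = a q + a it would follow that q + 2 ≤ a.
    j≯a : ¬ (a < j)
    j≯a a<j = ℕ.<⇒≱ (s≤s (ℕ.m≤n⇒m≤1+n a≤q)) (ℕ.+-cancelʳ-≤ (a ℕ.* q) _ _ bound)
      where
      bound : suc (suc q) ℕ.+ a ℕ.* q ≤ a ℕ.+ a ℕ.* q
      bound = ℕ.≤-trans (s≤s (s≤s (ℕ.*-monoˡ-≤ q a<j))) (subst (suc (suc (j ℕ.* q)) ≤_) (ℕ.*-suc a q) le)

  ±-∣ : ∀ {m} j x → m ∣ -1ℤ ^ j * x → m ∣ x
  ±-∣ {m} zero    x d = subst (m ∣_) (*-identityˡ x) d
  ±-∣ {m} (suc j) x d = ±-∣ j x (subst (m ∣_) (identity (-1ℤ ^ j) x) (∣m⇒∣-m d))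
    where
    identity : ∀ s x → - (-1ℤ * s * x) ≡ s * x
    identity = solve-∀

  -- What part (ii) uses about an even index, be it k itself or k - 1 for odd k. The field `1+l<q`
  -- makes l + 1 a residue modulo q, as the odd case requires, and gives l ≤ p - 3 for regularity.
  record Even-index (k : ℕ) : Set where
    field
      h j     : ℕ
      k≡l+jq  : k ≡ suc h ℕ.* 2 ℕ.+ j ℕ.* q
      1+l<q   : suc (suc h ℕ.* 2) < q
      p∣f     : P ∣ f k
      unit⇒   : vpℚ p (bernoulli (suc h ℕ.* 2)) ≡ + 0 → ¬ (P ^ 2 ∣ f k)
      ⇒unit   : ¬ (P ^ 2 ∣ f k) → vpℚ p (bernoulli (suc h ℕ.* 2)) ≡ + 0

  -- A chain of equivalences: p² divides f k, then e_l, then the power sum S_l, and finally p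
  -- divides B_l. The first link holds because k < a q gives j < a, so the factor a `G a′ j` is
  -- prime to p.
  even-index : ∀ x → x ℕ.* 2 < a ℕ.* q → ¬ (q ℕ.∣ x ℕ.* 2) → Even-index (x ℕ.* 2)
  even-index x k<aq q∤k with even-or-odd ((x ℕ.* 2) ℕ.% q)
  ... | inj₂ (h , l≡) with () ← trans (sym (%2-odd h))
      (trans (cong (ℕ._% 2) (sym l≡)) (trans (sym (+jq-%2 ((x ℕ.* 2) ℕ.% q) ((x ℕ.* 2) ℕ./ q)))
                                  (trans (cong (ℕ._% 2) (sym (ℕ.m≡m%n+[m/n]*n (x ℕ.* 2) q))) (%2-even x))))
  ... | inj₁ (zero , l≡) = ⊥-elim (q∤k (ℕ.m%n≡0⇒n∣m (x ℕ.* 2) q l≡))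
  ... | inj₁ (suc h , l≡) = record
    { h      = h
    ; j      = j
    ; k≡l+jq = k≡
    ; 1+l<q  = ℕ.≤∧≢⇒< l<q 1+l≢q
    ; p∣f    = F-∤ a k q∤k
    ; unit⇒  = λ unit d → vpℚ≡0⇒¬D₁ q pp 0<q (bernoulli-even≢0 h) (bernoulli-integral q pp 0<q l l<q) unit
                            (p²∣power-sum⇒D₁ q pp 0<q l l<q (e⇒S (f⇒e d)))
    ; ⇒unit  = λ nd → ¬D₁⇒vpℚ≡0 q pp 0<q (bernoulli-integral q pp 0<q l l<q)
                        (λ d₁ → nd (e⇒f (S⇒e (D₁⇒p²∣power-sum q pp 0<q l l<q d₁))))
    }
    where
    k l j : ℕ
    k = x ℕ.* 2
    l = suc h ℕ.* 2
    j = k ℕ./ q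
    S : ℤ
    S = power-sum +_ p l
    k≡ : k ≡ l ℕ.+ j ℕ.* q
    k≡ = trans (ℕ.m≡m%n+[m/n]*n k q) (cong (ℕ._+ j ℕ.* q) l≡)
    l<q : l < q
    l<q = subst (_< q) l≡ (ℕ.m%n<n k q)
    1+l≢q : suc l ≢ q
    -- l + 1 is odd while q is even.
    1+l≢q eq with () ← trans (sym (%2-odd (suc h))) (trans (cong (ℕ._% 2) (trans eq (proj₂ q-even)))
        (%2-even (proj₁ q-even)))
    j<a : j < a
    j<a = ℕ.*-cancelʳ-< q j a (ℕ.≤-<-trans (ℕ.m/n*n≤m k q) k<aq)
    unit : ¬ (P ∣ + a * G a′ j)
    unit = prime-∤-* pp {+ a} {G a′ j} p∤a (G-unit a′ j (ℕ.≤-pred j<a) (ℕ.m≤n⇒m≤1+n a≤q))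
    expansion : P ^ 2 ∣ f k - + a * G a′ j * e l
    expansion = subst (λ m → P ^ 2 ∣ f m - + a * G a′ j * e l) (sym k≡) (F-mod-p² l (s≤s (s≤s z≤n)) l<q a j)
    f⇒e : P ^ 2 ∣ f k → P ^ 2 ∣ e l
    f⇒e d = cancel-unit pp 2 {+ a * G a′ j} {e l} unit (∣-resp-+′ {a = f k} {b = + a * G a′ j * e l} expansion d)
    e⇒f : P ^ 2 ∣ e l → P ^ 2 ∣ f k
    e⇒f d = ∣-resp-+ {a = f k} {b = + a * G a′ j * e l} expansion (∣n⇒∣m*n (+ a * G a′ j) d)
    e⇒S : P ^ 2 ∣ e l → P ^ 2 ∣ S
    e⇒S d = ±-∣ (suc (h ℕ.* 2)) S (∣-resp-+′ {a = + l * e l} {b = -1ℤ ^ suc (h ℕ.* 2) * S}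
        (e-power-sum (h ℕ.* 2) l<q) (∣n⇒∣m*n (+ l) d))
    S⇒e : P ^ 2 ∣ S → P ^ 2 ∣ e l
    S⇒e d = cancel-unit pp 2 {+ l} {e l} (pos-∤ ℕ.z<s (ℕ.m≤n⇒m≤1+n l<q))
      (∣-resp-+ {a = + l * e l} {b = -1ℤ ^ suc (h ℕ.* 2) * S} (e-power-sum (h ℕ.* 2) l<q)
          (∣n⇒∣m*n (-1ℤ ^ suc (h ℕ.* 2)) d))

  -- If p divides k then k = c p with 0 < c < a < p, so k and ap - k = (a - c) p both have valuation
  -- exactly 1. Otherwise both are prime to p.
  valuation-n-k : ∀ k → 0 < k → k < n → ∃ λ u → ¬ (P ∣ u) × (+ n - + k ≡ P ^ vp p k * u) × vp p k ≤ 1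
  valuation-n-k k 0<k k<n with p ℕ.∣? k
  ... | no p∤k = subst (λ w → ∃ λ u → ¬ (P ∣ u) × (+ n - + k ≡ P ^ w * u) × w ≤ 1) (sym (vp-∤ q 0<q p∤k))
    (+ n - + k , (λ d → p∤k (∣⇒∣ᵤ (∣-resp-+′ {a = + n} {b = + k} d (∣ᵤ⇒∣ (ℕ.n∣m*n a))))) , sym
        (*-identityˡ (+ n - + k)) , z≤n)
  ... | yes (ℕ.divides c refl) = subst (λ w → ∃ λ u → ¬ (P ∣ u) × (+ n - + k ≡ P ^ w * u) × w ≤ 1) (sym vp≡1)
    (+ a - + c , p∤a-c , trans (cong₂ _-_ (pos-* a p) (pos-* c p)) (identity (+ a) (+ c) P) , s≤s z≤n)
    where
    c<a : c < a
    c<a = ℕ.*-cancelʳ-< p c a k<n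
    0<c : 0 < c
    0<c = ℕ.n≢0⇒n>0 (λ c≡0 → ℕ.<⇒≢ 0<k (sym (cong (ℕ._* p) c≡0)))
    vp≡1 : vp p (c ℕ.* p) ≡ 1
    vp≡1 = vp-exact q 0<q 1 0<k (subst (ℕ._∣ c ℕ.* p) (sym (ℕ.*-identityʳ p)) (ℕ.n∣m*n c))
      (λ d → ℕ.<⇒≱ (ℕ.<-≤-trans c<a (ℕ.m≤n⇒m≤1+n a≤q))
        (ℕ.∣⇒≤ {{ℕ.>-nonZero 0<c}} (ℕ.*-cancelˡ-∣ p (subst₂ ℕ._∣_ (cong (p ℕ.*_) (ℕ.*-identityʳ p))
            (ℕ.*-comm c p) d))))
    p∤a-c : ¬ (P ∣ + a - + c)
    p∤a-c d = pos-∤ (ℕ.m<n⇒0<n∸m c<a) (s≤s (ℕ.≤-trans (ℕ.m∸n≤m a c) a≤q))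
      (subst (P ∣_) (trans (m-n≡m⊖n a c) (⊖-≥ (ℕ.<⇒≤ c<a))) d)
    identity : ∀ a c p → a * p - c * p ≡ p * 1ℤ * (a - c)
    identity = solve-∀

  module _ (h w : ℕ) (u : ℤ) (p∤u : ¬ (P ∣ u)) (n-k≡ : + n - + (3 ℕ.+ h ℕ.* 2) ≡ P ^ w * u) (w≤1 : w ≤ 1) where
    private
      k : ℕ
      k = 3 ℕ.+ h ℕ.* 2

      -- The factor (ap - k) ap gives u a p^(w+1). In the bracket of `reflection` the second term
      -- has ap times f (k - 2), a multiple of p at an odd index, and the third has (ap)². So both
      -- vanish modulo p².
      odd-expansion : ∃ λ V → + 12 * f k ≡ P ^ suc w * (+ 6 * (u * + a) * f (2 ℕ.+ h ℕ.* 2) + P ^ 2 * V)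
      odd-expansion =
        let Z , eq = reflection (q ℕ.+ a′ ℕ.* p) h
            divides c f₁≡ = F-∤ a (1 ℕ.+ h ℕ.* 2) (q∤odd h)
            X , P⁴≡ = fourth w w≤1
            d = + (q ℕ.+ a′ ℕ.* p) - + k
        in _ , trans eq (trans (rewriting d (f (2 ℕ.+ h ℕ.* 2)) (f (h ℕ.* 2)) Z n-k≡ (pos-* a p) f₁≡)
                 (trans (collect (P ^ w) P u (+ a) d (f (2 ℕ.+ h ℕ.* 2)) c (f (h ℕ.* 2)) Z)
                   (trans (cong (λ t → P ^ suc w * (+ 6 * (u * + a) * f (2 ℕ.+ h ℕ.* 2) + P ^ 2 *
                       (u * + a * (- (+ 3 * (d + + 2) * + a * c) + (d + + 3) * (d + + 2) * + a * + a * f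
                       (h ℕ.* 2)))) + t * (+ a * + a * + a * + a * Z)) P⁴≡)
                     (regroup (P ^ suc w) (+ 6 * (u * + a) * f (2 ℕ.+ h ℕ.* 2)) (P ^ 2)
                        (u * + a * (- (+ 3 * (d + + 2) * + a * c) + (d + + 3) * (d + + 2) * + a * + a * f
                            (h ℕ.* 2))) X (+ a * + a * + a * + a * Z)))))
        where
        -- The remainder has to absorb p^(w+3), which divides p^4 exactly because w ≤ 1.
        fourth : ∀ w → w ≤ 1 → ∃ λ X → P * P * P * P ≡ P ^ suc w * (P ^ 2 * X)
        fourth 0 _ = P , identity P
          where
          identity : ∀ P → P * P * P * P ≡ P * 1ℤ * (P * (P * 1ℤ) * P)
          identity = solve-∀
        fourth 1 _ = 1ℤ , identity P
          where
          identity : ∀ P → P * P * P * P ≡ P * (P * 1ℤ) * (P * (P * 1ℤ) * 1ℤ)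
          identity = solve-∀
        fourth (suc (suc w)) (s≤s ())
        rewriting : ∀ d f₂ f₀ Z {x x′ y y′ f₁ f₁′} → x ≡ x′ → y ≡ y′ → f₁ ≡ f₁′ →
          x * y * (+ 6 * f₂ - + 3 * (d + + 2) * y * f₁ + (d + + 3) * (d + + 2) * y * y * f₀) + y * y * y * y * Z
          ≡ x′ * y′ * (+ 6 * f₂ - + 3 * (d + + 2) * y′ * f₁′ + (d + + 3) *
              (d + + 2) * y′ * y′ * f₀) + y′ * y′ * y′ * y′ * Z
        rewriting d f₂ f₀ Z refl refl refl = refl
        collect : ∀ W P u a d f₂ c f₀ Z →
          W * u * (a * P) * (+ 6 * f₂ - + 3 * (d + + 2) * (a * P) * (c * P) + (d + + 3) * (d + + 2) *
              (a * P) * (a * P) * f₀) + a * P * (a * P) * (a * P) * (a * P) * Z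
          ≡ P * W * (+ 6 * (u * a) * f₂ + P * (P * 1ℤ) *
              (u * a * (- (+ 3 * (d + + 2) * a * c) + (d + + 3) * (d + + 2) * a * a * f₀))) + P * P * P * P *
              (a * a * a * a * Z)
        collect = solve-∀
        regroup : ∀ W x Q y X z → W * (x + Q * y) + W * (Q * X) * z ≡ W * (x + Q * (y + X * z))
        regroup = solve-∀

      p∤12 : ¬ (P ∣ + 12)
      p∤12 = prime-∤-* pp {+ 6} {+ 2} p∤6 (pos-∤ ℕ.z<s (ℕ.≤-trans (s≤s (s≤s (s≤s z≤n))) (ℕ.m≤n⇒m≤1+n 4≤q)))

      p∤6ua : ¬ (P ∣ + 6 * (u * + a))
      p∤6ua = prime-∤-* pp {+ 6} {u * + a} p∤6 (prime-∤-* pp p∤u p∤a)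

    -- `odd-expansion` with 12 and 6 u a prime to p: modulo p², f (k - 1) determines f k / p^(w+1)
    -- up to a unit.
    odd-index : ∀ e → e ≤ 2 → P ^ e ∣ f (2 ℕ.+ h ℕ.* 2) → P ^ (suc w ℕ.+ e) ∣ f k
    odd-index e e≤2 d =
      let V , eq = odd-expansion
      in cancel-unit pp (suc w ℕ.+ e) {+ 12} {f k} p∤12 (subst₂ _∣_ (sym (^-distribˡ-+-* P (suc w) e)) (sym eq)
           (*-monoʳ-∣ (P ^ suc w) (∣m∣n⇒∣m+n (∣n⇒∣m*n (+ 6 * (u * + a)) d) (∣m⇒∣m*n V (^-monoʳ-∣ P e≤2)))))

    odd-index⁻¹ : ∀ e → e ≤ 2 → P ^ (suc w ℕ.+ e) ∣ f k → P ^ e ∣ f (2 ℕ.+ h ℕ.* 2)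
    odd-index⁻¹ e e≤2 d =
      let V , eq = odd-expansion
          sum = *-cancelˡ-∣ (P ^ suc w) {{subst ℤ.NonZero (sym (pos-^ (suc w))) (ℕ.m^n≢0 p (suc w))}}
                  (subst₂ _∣_ (^-distribˡ-+-* P (suc w) e) eq (∣n⇒∣m*n (+ 12) d))
      in cancel-unit pp e {+ 6 * (u * + a)} p∤6ua (∣m+n∣n⇒∣m sum (∣m⇒∣m*n V (^-monoʳ-∣ P e≤2)))

  mod-% : ∀ k m .{{_ : ℕ.NonZero m}} → k mod m ≡ k ℕ.% m
  mod-% k (suc m) = refl

  ε<q : ∀ k → ε k ℕ.% q ≡ ε k
  ε<q k = ℕ.m<n⇒m%n≡m (ℕ.<-≤-trans (ℕ.m%n<n k 2) (ℕ.≤-trans (s≤s (s≤s z≤n)) 4≤q))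

  Congruent : ℕ → Set
  Congruent k = k mod q ≡ ε k mod q

  congruent⇔% : ∀ k → Congruent k ⇔ (k ℕ.% q ≡ ε k)
  congruent⇔% k = mk⇔
    (λ eq → trans (sym (mod-% k q)) (trans eq (trans (mod-% (ε k) q) (ε<q k))))
    (λ eq → trans (mod-% k q) (trans eq (sym (trans (mod-% (ε k) q) (ε<q k)))))

-- Parts (i), (ii) and (iii) by the parity of k.

module Cases (q : ℕ) (pp : Prime (suc q)) (4≤q : 4 ≤ q) (a′ : ℕ) (a≤q : suc a′ ≤ q) where
  open import Defs
  open import Data.Nat
  open import Data.Nat.Properties
  open import Data.Nat.Divisibility using (_∣_; divides; n∣m⇒m%n≡0; m%n≡0⇒n∣m)
  open import Data.Nat.DivMod
  import Data.Integer as ℤ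
  import Data.Integer.Properties as ℤ
  import Data.Integer.Divisibility.Signed as ℤ
  open import Data.Integer using (+_)
  open import Data.Product using (_×_; _,_)
  open import Data.Sum using (inj₁; inj₂)
  open import Data.Empty using (⊥-elim)
  open import Function using (_∘_; _⇔_; mk⇔; Equivalence)
  open import Relation.Nullary using (¬_)
  open import Relation.Binary.PropositionalEquality
  open BernoulliNonzero using (even-or-odd)
  open Blocks q pp 4≤q using (p; P; q≢0; F-high)
  open Valuations q pp 4≤q a′ a≤q

  BernoulliUnit : ℕ → Set
  BernoulliUnit k = vpℚ p (bernoulli (2 * (⟨ k ⟩[ p ] / 2))) ≡ + 0

  -- Parts (i) and (ii), with r for the value (v_p(k) + 1) ε_k.
  Part-i Part-ii : ℕ → ℕ → Set
  Part-i  k r = Congruent k → v k ≡ r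
  Part-ii k r = k ≤ a * q ∸ 1 → ¬ Congruent k →
    (v k ≥ r + 1) × (v k ≡ r + 1 ⇔ BernoulliUnit k) × (Regular p → v k ≡ r + 1)

  1<a*q : 1 < a * q
  1<a*q = <-≤-trans (s≤s (s≤s z≤n)) (≤-trans 4≤q (m≤m+n q (a′ * q)))

  -- The common end of part (ii): k′ is k for even k and k - 1 for odd k. `down` and `up` translate
  -- p^(r+2) dividing f k into p² dividing f k′, which `Even-index` ties to the Bernoulli number.
  conclude : ∀ {k k′} r → k < n → (index : Even-index k′) → k % q / 2 * 2 ≡ suc (Even-index.h index) * 2 →
    P ℤ.^ suc r ℤ.∣ f k → (P ℤ.^ suc (suc r) ℤ.∣ f k → P ℤ.^ 2 ℤ.∣ f k′) →
        (P ℤ.^ 2 ℤ.∣ f k′ → P ℤ.^ suc (suc r) ℤ.∣ f k) →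
    (v k ≥ r + 1) × (v k ≡ r + 1 ⇔ BernoulliUnit k) × (Regular p → v k ≡ r + 1)
  conclude {k} r k<n index l≡ d down up rewrite +-comm r 1 =
    v-lower k<n (suc r) d , mk⇔ unit exact ,
        (λ regular → exact′ (regular l (m*n%n≡0 (suc h) 2) (s≤s (s≤s z≤n)) l≤q∸2))
    where
    open Even-index index
    l : ℕ
    l = suc h * 2
    ⟨k⟩≡ : 2 * (⟨ k ⟩[ p ] / 2) ≡ l
    ⟨k⟩≡ = trans (*-comm 2 (⟨ k ⟩[ p ] / 2)) (trans (cong (λ m → m / 2 * 2) (mod-% k q)) l≡)
    l≤q∸2 : l ≤ q ∸ 2
    l≤q∸2 = ∸-monoˡ-≤ 2 1+l<q
    exact′ : vpℚ p (bernoulli l) ≡ + 0 → v k ≡ suc r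
    exact′ u = v-exact k<n (suc r) d (unit⇒ u ∘ down)
    exact : BernoulliUnit k → v k ≡ suc r
    exact u = exact′ (subst (λ m → vpℚ p (bernoulli m) ≡ + 0) ⟨k⟩≡ u)
    unit : v k ≡ suc r → BernoulliUnit k
    unit eq = subst (λ m → vpℚ p (bernoulli m) ≡ + 0) (sym ⟨k⟩≡)
        (⇒unit (λ d₂ → <⇒≱ ≤-refl (subst (suc (suc r) ≤_) eq (v-lower k<n (suc (suc r)) (up d₂)))))

  even-case : ∀ x → suc (suc (x * 2)) ≤ n → ε (x * 2) ≡ 0 → Part-i (x * 2) 0 × Part-ii (x * 2) 0
  even-case x 2+k≤n ε≡0 = part-i , part-ii
    where
    k : ℕ
    k = x * 2
    k<n : k < n
    k<n = ≤-trans (n≤1+n (suc k)) 2+k≤n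
    congruent⇔∣ : Congruent k ⇔ (q ∣ k)
    congruent⇔∣ = mk⇔ (λ c → m%n≡0⇒n∣m k q (trans (Equivalence.to (congruent⇔% k) c) ε≡0))
                      (λ q∣k → Equivalence.from (congruent⇔% k) (trans (n∣m⇒m%n≡0 k q q∣k) (sym ε≡0)))
    part-i : Part-i k 0
    part-i c = v-exact k<n 0 (ℤ.divides (f k) (sym (ℤ.*-identityʳ (f k))))
        (f-multiple-unit k 2+k≤n (Equivalence.to congruent⇔∣ c) ∘ subst (ℤ._∣ f k) (ℤ.*-identityʳ P))
    part-ii : Part-ii k 0
    part-ii k≤ nc = conclude 0 k<n index l≡ (subst (ℤ._∣ f k) (sym (ℤ.*-identityʳ P)) p∣f) (λ d → d) (λ d → d)
      where
      index : Even-index k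
      index = even-index x (≤-<-trans k≤ (∸-monoʳ-< z<s (<⇒≤ 1<a*q))) (nc ∘ Equivalence.from congruent⇔∣)
      open Even-index index
      l≡ : k % q / 2 * 2 ≡ suc h * 2
      l≡ = trans (cong (λ m → m / 2 * 2)
          (trans (cong (_% q) k≡l+jq) (trans ([m+kn]%n≡m%n (suc h * 2) j q) (m<n⇒m%n≡m (<-trans (n<1+n _) 1+l<q)))))
                 (cong (_* 2) (m*n/n≡m (suc h) 2))

  odd-case : ∀ x → suc (suc (3 + x * 2)) ≤ n → ε (3 + x * 2) ≡ 1 → Part-i (3 + x * 2)
      (vp p (3 + x * 2) + 1) × Part-ii (3 + x * 2) (vp p (3 + x * 2) + 1)
  odd-case x 2+k≤n ε≡1 with valuation-n-k (3 + x * 2) z<s (≤-trans (n≤1+n (4 + x * 2)) 2+k≤n)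
  ... | u , p∤u , n-k≡ , w≤1 = part-i , part-ii
    where
    k k′ w : ℕ
    k  = 3 + x * 2
    k′ = suc x * 2
    w  = vp p k
    k<n : k < n
    k<n = ≤-trans (n≤1+n (suc k)) 2+k≤n
    ascend : ∀ e → e ≤ 2 → P ℤ.^ e ℤ.∣ f k′ → P ℤ.^ (e + suc w) ℤ.∣ f k
    ascend e e≤2 d = subst (λ m → P ℤ.^ m ℤ.∣ f k) (+-comm (suc w) e) (odd-index x w u p∤u n-k≡ w≤1 e e≤2 d)
    descend : ∀ e → e ≤ 2 → P ℤ.^ (e + suc w) ℤ.∣ f k → P ℤ.^ e ℤ.∣ f k′
    descend e e≤2 d = odd-index⁻¹ x w u p∤u n-k≡ w≤1 e e≤2 (subst (λ m → P ℤ.^ m ℤ.∣ f k) (+-comm e (suc w)) d)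
    -- For odd k the congruence is k ≡ 1, that is, q divides k - 1.
    congruent⇔∣ : Congruent k ⇔ (q ∣ k′)
    congruent⇔∣ = mk⇔
      (λ c → divides (k / q) (suc-injective
          (trans (m≡m%n+[m/n]*n k q) (cong (_+ k / q * q) (trans (Equivalence.to (congruent⇔% k) c) ε≡1)))))
      (λ { (divides j eq) → Equivalence.from (congruent⇔% k) (trans (cong (λ m → suc m % q) eq)
        (trans ([m+kn]%n≡m%n 1 j q) (trans (m<n⇒m%n≡m (≤-trans (s≤s (s≤s z≤n)) 4≤q)) (sym ε≡1)))) })
    part-i : Part-i k (w + 1)
    part-i c = trans (v-exact k<n (suc w) (ascend 0 z≤n (ℤ.divides (f k′) (sym (ℤ.*-identityʳ (f k′)))))
        (f-multiple-unit k′ (≤-trans (n≤1+n _) 2+k≤n) (Equivalence.to congruent⇔∣ c) ∘ subst (ℤ._∣ f k′)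
            (ℤ.*-identityʳ P) ∘ descend 1 (s≤s z≤n)))
        (+-comm 1 w)
    part-ii : Part-ii k (w + 1)
    part-ii k≤ nc rewrite +-comm w 1 = conclude (suc w) k<n index l≡
        (ascend 1 (s≤s z≤n) (subst (ℤ._∣ f k′) (sym (ℤ.*-identityʳ P)) p∣f)) (descend 2 ≤-refl) (ascend 2 ≤-refl)
      where
      index : Even-index k′
      index = even-index (suc x) (<-trans (n<1+n k′) (≤-<-trans k≤ (∸-monoʳ-< z<s (<⇒≤ 1<a*q))))
          (nc ∘ Equivalence.from congruent⇔∣)
      open Even-index index
      l≡ : k % q / 2 * 2 ≡ suc h * 2
      -- The residue of k is l + 1 without wrapping around, and halving rounds it down to l.
      l≡ = trans (cong (λ m → m / 2 * 2) (trans (cong (λ m → suc m % q) k≡l+jq)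
                   (trans ([m+kn]%n≡m%n (suc (suc h * 2)) j q) (m<n⇒m%n≡m 1+l<q))))
                 (cong (_* 2) (half (suc h)))
        where
        half : ∀ m → suc (m * 2) / 2 ≡ m
        half m = trans (+-distrib-/-∣ʳ 1 {m * 2} {2} (divides m refl)) (m*n/n≡m m 2)

  2+k≤n : ∀ {k} → k ≤ n ∸ 2 → suc (suc k) ≤ n
  2+k≤n {k} k≤ = subst (suc (suc k) ≤_) (m+[n∸m]≡n (≤-trans (≤-trans (s≤s (s≤s z≤n)) (≤-trans 4≤q (n≤1+n q)))
      (m≤m+n p (a′ * p)))) (s≤s (s≤s k≤))

  all-cases : ∀ k → 2 ≤ k → k ≤ n ∸ 2 → Part-i k ((vp p k + 1) * ε k) × Part-ii k ((vp p k + 1) * ε k)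
  all-cases k 2≤k k≤ with even-or-odd k
  ... | inj₁ (x , refl) = subst (λ r → Part-i k r × Part-ii k r)
      (sym (trans (cong ((vp p k + 1) *_) (%2-even x)) (*-zeroʳ (vp p k + 1))))
                            (even-case x (2+k≤n k≤) (%2-even x))
  ... | inj₂ (zero , refl) = ⊥-elim (<⇒≱ 2≤k ≤-refl)
  ... | inj₂ (suc x , refl) = subst (λ r → Part-i k r × Part-ii k r)
      (sym (trans (cong ((vp p k + 1) *_) (%2-odd (suc x))) (*-identityʳ (vp p k + 1))))
                            (odd-case x (2+k≤n k≤) (%2-odd (suc x)))

  -- With r = a + k - ap the bound a q + r in `F-high` equals k, because ap = a + a q.
  part-iii : ∀ k → k ≤ n ∸ 2 → a * q + 2 ≤ k → v k ≥ a + k ∸ n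
  part-iii k k≤ le = v-lower (≤-trans (n≤1+n (suc k)) (2+k≤n k≤)) (a + k ∸ n)
      (F-high a (a + k ∸ n) k (≤-reflexive (trans (cong (λ m → a * q + (a + k ∸ m)) (*-suc a q))
    (trans (cong (_+_ (a * q)) ([m+n]∸[m+o]≡n∸o a k (a * q))) (m+[n∸m]≡n (≤-trans (m≤m+n (a * q) 2) le))))))

open import Data.Nat using (s≤s; _+_; _*_; _∸_; _/_; _≥_)
open import Defs
open import Data.Integer using (+_)
open import Data.Product using (_×_; _,_)
open import Function.Bundles using (_⇔_)
open import Relation.Binary.PropositionalEquality using (_≡_; _≢_)

theorem1p1 : (p a k : ℕ) → Prime p → 5 ≤ p → 1 ≤ a → a ≤ p ∸ 1 → 2 ≤ k → k ≤ a * p ∸ 2 →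
    ((k mod (p ∸ 1) ≡ ε k mod (p ∸ 1)) →
    vp p (stirling1 (a * p) (a * p ∸ k)) ≡ (vp p k + 1) * ε k)
    × ((k ≤ a * (p ∸ 1) ∸ 1 → k mod (p ∸ 1) ≢ ε k mod (p ∸ 1) →
    (vp p (stirling1 (a * p) (a * p ∸ k)) ≥ (vp p k + 1) * ε k + 1)
    × ((vp p (stirling1 (a * p) (a * p ∸ k)) ≡ (vp p k + 1) * ε k + 1)
    ⇔ (vpℚ p (bernoulli (2 * (⟨ k ⟩[ p ] / 2))) ≡ + 0))
    × (Regular p → vp p (stirling1 (a * p) (a * p ∸ k)) ≡ (vp p k + 1) * ε k + 1)))
    × (4 ≤ a → a * (p ∸ 1) + 2 ≤ k →
    vp p (stirling1 (a * p) (a * p ∸ k)) ≥ a + k ∸ a * p)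
theorem1p1 (suc q) (suc a′) k pp (s≤s 4≤q) _ a≤q 2≤k k≤ =
  let open Cases q pp 4≤q a′ a≤q
      part-i , part-ii = all-cases k 2≤k k≤
  in part-i , part-ii , λ _ → part-iii k k≤
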